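{- Let $t\geq 3$ be an integer and let $n\ge 1$. Every edge-colored complete balanced bipartite graph $K^c_{n,n}$ with $\delta^c(K^c_{n,n})\geq \frac{2n}{3}+t$ contains a properly colored 2-factor $H$ such that every cycle of $H$ has length at least $t$.
   Context: $K^c_{n,n}$ denotes the complete bipartite graph $K_{n,n}$ together with an arbitrary assignment of a color to each edge. A subgraph is properly colored (PC) if every two adjacent edges of it have distinct colors. The color degree $d^c(v)$ of a vertex $v$ is the number of distinct colors on the edges incident to $v$, and $\delta^c(K^c_{n,n})=\min_v d^c(v)$. A 2-factor is a spanning 2-regular subgraph (a vertex-disjoint union of cycles covering all vertices). -}

module Defs where

open import Data.Nat using (ℕ; _≤_; _≟_)
open import Data.Fin using (Fin)
open import Data.List using (List; []; _∷_; _++_; [_]; zip; map; length; deduplicate; concat; allFin)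
open import Data.List.Relation.Unary.All using (All)
open import Data.List.Relation.Unary.Unique.Propositional using (Unique)
open import Data.List.Membership.Propositional using (_∈_)
open import Data.Unit using (⊤)
open import Data.Empty using (⊥)
open import Data.Sum using (_⊎_; inj₁; inj₂)
open import Data.Product using (_×_; _,_; proj₁; proj₂)
open import Relation.Binary.PropositionalEquality using (_≡_; _≢_)

-- Vertices of K_{n,n}: inj₁ i is the i-th left vertex, inj₂ j the j-th right vertex.
V : ℕ → Set
V n = Fin n ⊎ Fin n

-- An edge-coloring of K_{n,n}: colour of the edge between left i and right j.
-- Colours are natural numbers (any colour set of a finite graph can be taken to be so).
Coloring : ℕ → Set
Coloring n = Fin n → Fin n → ℕ

Adj : ∀ {n} → V n → V n → Set
Adj (inj₁ _) (inj₂ _) = ⊤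
Adj (inj₂ _) (inj₁ _) = ⊤
Adj (inj₁ _) (inj₁ _) = ⊥
Adj (inj₂ _) (inj₂ _) = ⊥

-- Colour of the edge uv (only meaningful when Adj u v; 0 otherwise).
col : ∀ {n} → Coloring n → V n → V n → ℕ
col c (inj₁ i) (inj₂ j) = c i j
col c (inj₂ j) (inj₁ i) = c i j
col c _ _ = 0

colorDegree : ∀ {n} → Coloring n → V n → ℕ
colorDegree {n} c (inj₁ i) = length (deduplicate _≟_ (map (λ j → c i j) (allFin n)))
colorDegree {n} c (inj₂ j) = length (deduplicate _≟_ (map (λ i → c i j) (allFin n)))

rotate : {A : Set} → List A → List A
rotate []       = []
rotate (x ∷ xs) = xs ++ [ x ]

-- A cycle is given by its cyclic vertex sequence x₀ … x_{k-1};
-- its edges are x_i x_{i+1 mod k}.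
cycleEdges : {A : Set} → List A → List (A × A)
cycleEdges xs = zip xs (rotate xs)

-- Pairs of consecutive edges (x_i x_{i+1}, x_{i+1} x_{i+2}) : exactly the
-- pairs of adjacent edges of the cycle (when the vertices are distinct).
consecutiveEdges : {A : Set} → List A → List ((A × A) × (A × A))
consecutiveEdges xs = zip (cycleEdges xs) (rotate (cycleEdges xs))

-- xs is (the vertex sequence of) a cycle of K_{n,n}: at least 3 vertices,
-- consecutive vertices adjacent (vertex-distinctness is imposed globally below).
IsCycle : ∀ {n} → List (V n) → Set
IsCycle xs = (3 ≤ length xs) × All (λ e → Adj (proj₁ e) (proj₂ e)) (cycleEdges xs)

IsPCCycle : ∀ {n} → Coloring n → List (V n) → Set
IsPCCycle c xs =
  All (λ p → col c (proj₁ (proj₁ p)) (proj₂ (proj₁ p)) ≢ col c (proj₁ (proj₂ p)) (proj₂ (proj₂ p)))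
      (consecutiveEdges xs)

Is2Factor : ∀ {n} → List (List (V n)) → Set
Is2Factor {n} H = All IsCycle H × Unique (concat H) × (∀ (v : V n) → v ∈ concat H)

-- A properly coloured 2-factor: a 2-factor all of whose cycles are PC
-- (cycles are vertex-disjoint, so adjacent edges lie in the same cycle).
IsPC2Factor : ∀ {n} → Coloring n → List (List (V n)) → Set
IsPC2Factor c H = Is2Factor H × All (IsPCCycle c) H

{-# OPTIONS --safe #-}
module Submission where

-- A colour occurs at most k times at each vertex, where 3k + 3t ≤ n + 3.  Start from the rainbow
-- colouring, for which any Hamilton cycle will do, and restore the colours of c one edge at a time.
-- If the edge xy being restored spoils the current 2-factor H, exchange three edges:
--   H − xy − vv′ − ww′ + xv + v′w + w′y      (or H − xy − vv′ + xv + v′y),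
-- where vv′ ranges over a set P of edges of H such that xv creates no colour conflict, and ww′ over a
-- set Q such that w′y creates none.  As the two edges of H at a vertex have different colours, all but
-- about k vertices v (resp. w′) contribute to P (resp. Q), so |P|, |Q| > 2k with room to spare.
-- The exchange fails only if c(v′w) is the colour of the edge kept at v′ or at w.  A vertex v′ with
-- both its edges in P can avoid the first conflict and a vertex w with both edges in Q the second, so
-- if A, B count the vertices v′, w that occur, and b, f those that occur exactly once, universal
-- failure gives AB ≤ kb + kf, which is impossible for these sizes.  The 3t in the hypothesis leaves
-- room to demand that the three removed edges are far apart in H, so that no short cycle arises.

open import Defs
open import Data.Nat using (ℕ; zero; suc; _≤_; _<_; _+_; _*_; _∸_; z≤n; s≤s; s≤s⁻¹; _≟_; _<?_)
open import Data.Nat.Properties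
open import Data.Nat.DivMod using (_/_; _%_; m%n<n; m%n%n≡m%n; %-distribˡ-+; m<n⇒m%n≡m; [m+n]%n≡m%n; m≡m%n+[m/n]*n; /-monoˡ-≤; m*n/n≡m; m/n*n≤m)
open import Data.Nat.Divisibility using (divides; ∣⇒≤)
open import Data.Nat.Tactic.RingSolver using (solve-∀)
open import Data.Bool using (Bool; true; false; not; _∨_; _∧_; _xor_; if_then_else_)
open import Data.Bool.Properties as Bool using (not-involutive; not-¬)
open import Data.Fin as Fin using (Fin; toℕ; fromℕ<; combine; join; splitAt)
open import Data.Fin.Properties as Fin using (any?; toℕ<n; toℕ-fromℕ<; toℕ-injective; combine-injective; pigeonhole; splitAt-join)
open import Data.List using (List; []; _∷_; _++_; [_]; map; length; filter; deduplicate; tabulate; allFin; upTo; concat; zip; iterate)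
open import Data.List.Properties using (length-map; length-++; length-upTo; length-filter; length-iterate; map-++; map-∘; map-tabulate; filter-accept; filter-reject)
open import Data.List.Relation.Unary.Any as Any using (Any; here; there)
open import Data.List.Relation.Unary.All as All using (All; []; _∷_)
import Data.List.Relation.Unary.All.Properties as All
open import Data.List.Relation.Unary.AllPairs using (AllPairs; []; _∷_)
open import Data.List.Relation.Unary.Unique.Propositional using (Unique)
import Data.List.Relation.Unary.Unique.Propositional.Properties as Unique
open import Data.List.Relation.Binary.Sublist.Propositional.Properties using (filter-⊆; filter⁺; length-mono-≤)
open import Data.List.Membership.Propositional using (_∈_; _∉_)
open import Data.List.Membership.Propositional.Properties using (∈-map⁺; ∈-map⁻; ∈-++⁺ˡ; ∈-++⁺ʳ; ∈-++⁻; ∈-upTo⁺; ∈-upTo⁻; ∈-allFin)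
open import Data.Product using (Σ; ∃; _×_; _,_; proj₁; proj₂)
import Data.Product.Properties as Product
open import Data.Sum using (_⊎_; inj₁; inj₂)
open import Data.Sum.Properties as Sum using (inj₁-injective; inj₂-injective)
open import Data.Unit using (tt)
open import Data.Empty using (⊥; ⊥-elim)
open import Function using (_∘_; case_of_; id)
open import Relation.Nullary using (¬_; Dec; yes; no; does; ¬?; _×-dec_; _⊎-dec_)
open import Relation.Nullary.Decidable using (dec-true; dec-false; map′; decidable-stable)
open import Relation.Binary.PropositionalEquality hiding ([_])
open import Algebra.Properties.CommutativeMonoid.Sum +-0-commutativeMonoid using (sum; ∑-distrib-+; ∑-comm; sum-cong-≗)
open import Algebra.Properties.Semiring.Sum +-*-semiring using (*-distribˡ-sum; *-distribʳ-sum)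

-- Two-regular bipartite multigraphs as pairings of darts, walks along their cycles, and surgery on
-- them.

side : ∀ {n} → V n → Bool
side (inj₁ _) = true
side (inj₂ _) = false

Dart : ℕ → Set
Dart n = V n × Bool

vtx : ∀ {n} → Dart n → V n
vtx = proj₁

flip : ∀ {n} → Dart n → Dart n
flip (v , b) = v , not b

flip-involutive : ∀ {n} (s : Dart n) → flip (flip s) ≡ s
flip-involutive (v , b) = cong (v ,_) (not-involutive b)

flip≢ : ∀ {n} (s : Dart n) → flip s ≢ s
flip≢ (v , b) eq = not-¬ refl (sym (cong proj₂ eq))

same-vtx : ∀ {n} (s s′ : Dart n) → vtx s ≡ vtx s′ → s′ ≡ s ⊎ s′ ≡ flip s
same-vtx (v , true)  (.v , true)  refl = inj₁ refl
same-vtx (v , true)  (.v , false) refl = inj₂ refl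
same-vtx (v , false) (.v , true)  refl = inj₂ refl
same-vtx (v , false) (.v , false) refl = inj₁ refl

-- A 2-regular bipartite multigraph: each vertex v carries the two darts
-- (v , true) and (v , false), and rev pairs up the two darts of each edge.
record TwoRegular (n : ℕ) : Set where
  field
    rev        : Dart n → Dart n
    involutive : ∀ s → rev (rev s) ≡ s
    crossing   : ∀ s → side (vtx (rev s)) ≡ not (side (vtx s))

module Walk {n : ℕ} (H : TwoRegular n) where
  open TwoRegular H public

  -- Cross the edge of the dart, then leave the vertex reached by its other edge. The orbits of `σ`
  -- are the cycles of `H`, once for each direction.
  σ : Dart n → Dart n
  σ s = flip (rev s)

  walk : ℕ → Dart n → Dart n
  walk zero    s = s
  walk (suc i) s = walk i (σ s)

  flip-σ : ∀ s → flip (σ s) ≡ rev s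
  flip-σ s = flip-involutive (rev s)

  σ-rev : ∀ s → σ (rev s) ≡ flip s
  σ-rev s = cong flip (involutive s)

  σ-flip-σ : ∀ s → σ (flip (σ s)) ≡ flip s
  σ-flip-σ s = trans (cong σ (flip-σ s)) (σ-rev s)

  walk-suc : ∀ i s → walk (suc i) s ≡ σ (walk i s)
  walk-suc zero    s = refl
  walk-suc (suc i) s = walk-suc i (σ s)

  walk-+ : ∀ i j s → walk (i + j) s ≡ walk j (walk i s)
  walk-+ zero    j s = refl
  walk-+ (suc i) j s = walk-+ i j (σ s)

  rev≢ : ∀ s → rev s ≢ s
  rev≢ s eq = not-¬ refl (trans (sym (cong (λ d → side (vtx d)) eq)) (crossing s))

  rev-injective : ∀ {s s′} → rev s ≡ rev s′ → s ≡ s′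
  rev-injective {s} {s′} eq = trans (sym (involutive s)) (trans (cong rev eq) (involutive s′))

  flip-injective : ∀ {s s′ : Dart n} → flip s ≡ flip s′ → s ≡ s′
  flip-injective {s} {s′} eq = trans (sym (flip-involutive s)) (trans (cong flip eq) (flip-involutive s′))

  -- Both `flip` and `rev` conjugate `σ` to its inverse, so a walk is retraced after turning round.
  walk-flip : ∀ i s → walk i (flip (walk i s)) ≡ flip s
  walk-flip zero    s = refl
  walk-flip (suc i) s = begin
    walk i (σ (flip (walk (suc i) s))) ≡⟨ cong (λ d → walk i (σ (flip d))) (walk-suc i s) ⟩
    walk i (σ (flip (σ (walk i s))))   ≡⟨ cong (walk i) (σ-flip-σ (walk i s)) ⟩
    walk i (flip (walk i s))           ≡⟨ walk-flip i s ⟩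
    flip s                             ∎
    where open ≡-Reasoning

  walk-rev : ∀ i s → walk i (rev (walk i s)) ≡ rev s
  walk-rev zero    s = refl
  walk-rev (suc i) s = begin
    walk i (σ (rev (walk (suc i) s))) ≡⟨ cong (walk i) (σ-rev (walk (suc i) s)) ⟩
    walk i (flip (walk (suc i) s))    ≡⟨ cong (λ d → walk i (flip d)) (walk-suc i s) ⟩
    walk i (flip (σ (walk i s)))      ≡⟨ cong (walk i) (flip-σ (walk i s)) ⟩
    walk i (rev (walk i s))           ≡⟨ walk-rev i s ⟩
    rev s                             ∎
    where open ≡-Reasoning

  -- Otherwise the middle of the palindromic walk from s to rev s would be a fixed point of flip or rev.
  walk≢rev : ∀ i s → walk i s ≢ rev s
  walk≢rev zero          s eq = rev≢ s (sym eq)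
  walk≢rev (suc zero)    s eq = flip≢ (rev s) eq
  walk≢rev (suc (suc i)) s eq = walk≢rev i (σ s) (rev-injective (begin
    rev (walk i (σ s))        ≡⟨ flip-σ _ ⟨
    flip (σ (walk i (σ s)))   ≡⟨ cong flip (walk-suc i (σ s)) ⟨
    flip (walk (suc i) (σ s)) ≡⟨ cong flip eq ⟩
    σ s                       ≡⟨ involutive (σ s) ⟨
    rev (rev (σ s))           ∎))
    where open ≡-Reasoning

  side-σ : ∀ s → side (vtx (σ s)) ≡ not (side (vtx s))
  side-σ s = crossing s

  side-walk-even : ∀ l s → side (vtx (walk (l * 2) s)) ≡ side (vtx s)
  side-walk-even zero    s = refl
  side-walk-even (suc l) s = trans (side-walk-even l (σ (σ s)))
    (trans (side-σ (σ s)) (trans (cong not (side-σ s)) (not-involutive _)))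

  side-walk-odd : ∀ l s → side (vtx (walk (suc (l * 2)) s)) ≡ not (side (vtx s))
  side-walk-odd l s = trans (side-walk-even l (σ s)) (side-σ s)

  -- Closed walks have even length, so this says that every cycle has at least `2 * h + 2` vertices;
  -- a double edge counts as a cycle of length 2.
  Long : ℕ → Set
  Long h = ∀ i s → 1 ≤ i → i ≤ h * 2 → walk i s ≢ s

  -- All four combinations of orientations are covered, as either edge may be traversed either way.
  -- Length 0 is exempt: disjointness of the edges is asked for separately, by `Apart`.
  Far : ℕ → Dart n → Dart n → Set
  Far h d e = ∀ i → 1 ≤ i → i ≤ h * 2 →
    (walk i d ≢ e × walk i d ≢ rev e) × (walk i (rev d) ≢ e × walk i (rev d) ≢ rev e)

  walk-rev′ : ∀ i {s s′} → walk i s ≡ s′ → walk i (rev s′) ≡ rev s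
  walk-rev′ i {s} refl = walk-rev i s

  Far-rev : ∀ {h d e} → Far h (rev d) (rev e) → Far h d e
  Far-rev {h} {d} {e} far i 1≤i i≤ with far i 1≤i i≤
  ... | (p , q) , (r , t) =
    ((λ eq → t (trans (cong (walk i) (involutive d)) (trans eq (sym (involutive e)))))
    , (λ eq → r (trans (cong (walk i) (involutive d)) eq)))
    , ((λ eq → q (trans eq (sym (involutive e)))) , p)

  Far-sym : ∀ {h d e} → Far h d e → Far h e d
  Far-sym {h} {d} {e} far i 1≤i i≤ with far i 1≤i i≤
  ... | (p , q) , (r , t) =
    ((λ eq → t (walk-rev′ i eq)) , (λ eq → q (trans (sym (cong (walk i) (involutive d))) (walk-rev′ i eq))))
    , ((λ eq → r (trans (walk-rev′ i eq) (involutive e)))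
      , (λ eq → p (trans (sym (cong (walk i) (involutive d))) (trans (walk-rev′ i eq) (involutive e)))))

  OnEdge : Dart n → Dart n → Set
  OnEdge s d = s ≡ d ⊎ s ≡ rev d

  On : List (Dart n) → Dart n → Set
  On ds s = Any (OnEdge s) ds

  OnEdge-rev : ∀ {s d} → OnEdge s d → OnEdge (rev s) d
  OnEdge-rev (inj₁ refl)     = inj₂ refl
  OnEdge-rev {d = d} (inj₂ refl) = inj₁ (involutive d)

  OnEdge-unique : ∀ {s s′ d} → OnEdge s d → OnEdge s′ d → s′ ≡ s ⊎ s′ ≡ rev s
  OnEdge-unique (inj₁ refl) (inj₁ refl) = inj₁ refl
  OnEdge-unique (inj₁ refl) (inj₂ refl) = inj₂ refl
  OnEdge-unique {d = d} (inj₂ refl) (inj₁ refl) = inj₂ (sym (involutive d))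
  OnEdge-unique (inj₂ refl) (inj₂ refl) = inj₁ refl

  Far-OnEdge : ∀ {h d e s s′} → Far h d e → OnEdge s d → OnEdge s′ e →
               ∀ i → 1 ≤ i → i ≤ h * 2 → walk i s ≢ s′
  Far-OnEdge far (inj₁ refl) (inj₁ refl) i p q = proj₁ (proj₁ (far i p q))
  Far-OnEdge far (inj₁ refl) (inj₂ refl) i p q = proj₂ (proj₁ (far i p q))
  Far-OnEdge far (inj₂ refl) (inj₁ refl) i p q = proj₁ (proj₂ (far i p q))
  Far-OnEdge far (inj₂ refl) (inj₂ refl) i p q = proj₂ (proj₂ (far i p q))

  -- Only short walks from an edge of the list to itself escape pairwise farness; these are left to
  -- `Long` and `walk≢rev`.
  Far-On : ∀ {h ds s s′} → AllPairs (Far h) ds → On ds s → On ds s′ →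
           ∀ i → 1 ≤ i → i ≤ h * 2 → walk i s ≡ s′ → s′ ≡ s ⊎ s′ ≡ rev s
  Far-On {h} (_ ∷ _)    (here p)  (here q)  i 1≤i i≤ eq = OnEdge-unique p q
  Far-On {h} (far ∷ _)  (here p)  (there q) i 1≤i i≤ eq with All.lookupAny far q
  ... | f , q′ = ⊥-elim (Far-OnEdge {h} f p q′ i 1≤i i≤ eq)
  Far-On {h} (far ∷ _)  (there p) (here q)  i 1≤i i≤ eq with All.lookupAny far p
  ... | f , p′ = ⊥-elim (Far-OnEdge {h} (Far-sym {h} f) p′ q i 1≤i i≤ eq)
  Far-On {h} (_ ∷ fars) (there p) (there q) i 1≤i i≤ eq = Far-On {h} fars p q i 1≤i i≤ eq

-- A short closed walk of H′ through T, cut at its first return to T, contains a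
-- walk of H between two darts of T; all such walks are long.
module Surgery {n : ℕ} (H H′ : TwoRegular n)
  (T : Dart n → Set) (T? : ∀ s → Dec (T s))
  (agree : ∀ s → ¬ T s → TwoRegular.rev H′ s ≡ TwoRegular.rev H s)
  (T-rev : ∀ s → T s → T (TwoRegular.rev H s))
  (T-rev′ : ∀ s → T s → T (TwoRegular.rev H′ s)) where

  open Walk H
  module W′ = Walk H′

  -- The walks of `H′` and `H` can part only on leaving a dart of `T`, so they coincide up to the
  -- first such dart.
  agree-or-return : ∀ j s → (W′.walk j s ≡ walk j s) ⊎ (∃ λ i → i < j × T (walk i s) × W′.walk i s ≡ walk i s)
  agree-or-return zero s = inj₁ refl
  agree-or-return (suc j) s with T? s
  ... | yes ts = inj₂ (0 , s≤s z≤n , ts , refl)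
  ... | no ¬ts with agree-or-return j (σ s)
  ...   | inj₁ eq = inj₁ (trans (cong (W′.walk j) (cong flip (agree s ¬ts))) eq)
  ...   | inj₂ (i , i<j , ti , eq) = inj₂ (suc i , s≤s i<j , ti , trans (cong (W′.walk i) (cong flip (agree s ¬ts))) eq)

  long : ∀ {h} → Long h →
         (∀ {s s′} → T s → T s′ → ∀ i → 1 ≤ i → i ≤ h * 2 → walk i s ≡ s′ → s′ ≡ s ⊎ s′ ≡ rev s) →
         W′.Long h
  long {h} lng far j s 1≤j j≤ closed with agree-or-return j s
  ... | inj₁ eq = lng j s 1≤j j≤ (trans (sym eq) closed)
  ... | inj₂ (a , a<j , ta , eqa) = fromT (walk a s) ta j 1≤j j≤ rotated
    where
    -- The closed walk is restarted at its first dart in `T`.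
    rotated : W′.walk j (walk a s) ≡ walk a s
    rotated = begin
      W′.walk j (walk a s)    ≡⟨ cong (W′.walk j) eqa ⟨
      W′.walk j (W′.walk a s) ≡⟨ W′.walk-+ a j s ⟨
      W′.walk (a + j) s       ≡⟨ cong (λ m → W′.walk m s) (+-comm a j) ⟩
      W′.walk (j + a) s       ≡⟨ W′.walk-+ j a s ⟩
      W′.walk a (W′.walk j s) ≡⟨ cong (W′.walk a) closed ⟩
      W′.walk a s             ≡⟨ eqa ⟩
      walk a s                ∎
      where open ≡-Reasoning
    -- As `σ (rev r)` is `flip r`, one step put in front makes this a walk of `H` between two darts
    -- of `T`. By `far` it ends at its start or at the reverse of its start, against `Long` and
    -- `walk≢rev`.
    segment : ∀ {r} → T r → ∀ i → i < h * 2 → T (walk i (flip r)) → ⊥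
    segment {r} tr i i< ti = contra (far (T-rev r tr) ti (suc i) (s≤s z≤n) i< step)
      where
      step : walk (suc i) (rev r) ≡ walk i (flip r)
      step = cong (walk i) (σ-rev r)
      contra : ¬ (walk i (flip r) ≡ rev r ⊎ walk i (flip r) ≡ rev (rev r))
      contra (inj₁ eq) = lng (suc i) (rev r) (s≤s z≤n) i< (trans step eq)
      contra (inj₂ eq) = walk≢rev (suc i) (rev r) (trans step eq)
    -- The first step in `H′` leads to the flip of the new partner of `s`; from there the walk
    -- follows `H` until it meets `T` again, at the latest on closing up at `s`.
    fromT : ∀ s → T s → ∀ j → 1 ≤ j → j ≤ h * 2 → W′.walk j s ≢ s
    fromT s ts (suc j) _ j≤ closed with agree-or-return j (W′.σ s)
    ... | inj₁ eq = segment (T-rev′ s ts) j j≤ (subst T (sym (trans (sym eq) closed)) ts)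
    ... | inj₂ (i , i<j , ti , _) = segment (T-rev′ s ts) i (<-trans i<j j≤) ti

-- Sums and counts over `Fin n`.

χ : Bool → ℕ
χ true  = 1
χ false = 0

sum-mono : ∀ {n} {f g : Fin n → ℕ} → (∀ i → f i ≤ g i) → sum f ≤ sum g
sum-mono {zero}  f≤g = z≤n
sum-mono {suc n} f≤g = +-mono-≤ (f≤g Fin.zero) (sum-mono (f≤g ∘ Fin.suc))

term≤sum : ∀ {n} (f : Fin n → ℕ) i → f i ≤ sum f
term≤sum f Fin.zero    = m≤m+n _ _
term≤sum f (Fin.suc i) = ≤-trans (term≤sum (f ∘ Fin.suc) i) (m≤n+m _ _)

sum-zero : ∀ {n} (f : Fin n → ℕ) → (∀ i → f i ≡ 0) → sum f ≡ 0
sum-zero {zero}  f z = refl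
sum-zero {suc n} f z = cong₂ _+_ (z Fin.zero) (sum-zero (f ∘ Fin.suc) (z ∘ Fin.suc))

count : ∀ {n} {P : Fin n → Set} → (∀ i → Dec (P i)) → ℕ
count P? = sum (λ i → χ (does (P? i)))

χ-yes : ∀ {P : Set} (P? : Dec P) → P → χ (does P?) ≡ 1
χ-yes P? p = cong χ (dec-true P? p)

χ-no : ∀ {P : Set} (P? : Dec P) → ¬ P → χ (does P?) ≡ 0
χ-no P? ¬p = cong χ (dec-false P? ¬p)

χ-≤ : ∀ {P : Set} (P? : Dec P) {m} → (P → 1 ≤ m) → χ (does P?) ≤ m
χ-≤ (yes p) 1≤m = 1≤m p
χ-≤ (no _)  1≤m = z≤n

count≤1 : ∀ {n} {P : Fin n → Set} (P? : ∀ i → Dec (P i)) → (∀ i j → P i → P j → i ≡ j) → count P? ≤ 1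
count≤1 {zero}  P? uniq = z≤n
count≤1 {suc n} P? uniq with P? Fin.zero
... | yes p = s≤s (≤-reflexive (sum-zero _ λ i → χ-no (P? (Fin.suc i)) λ q → Fin.0≢1+n (uniq Fin.zero (Fin.suc i) p q)))
... | no ¬p = count≤1 (P? ∘ Fin.suc) (λ i j p q → Fin.suc-injective (uniq (Fin.suc i) (Fin.suc j) p q))

count-mono : ∀ {n} {P Q : Fin n → Set} (P? : ∀ i → Dec (P i)) (Q? : ∀ i → Dec (Q i)) →
             (∀ i → P i → Q i) → count P? ≤ count Q?
count-mono P? Q? P⊆Q = sum-mono λ i → χ-≤ (P? i) λ p → ≤-reflexive (sym (χ-yes (Q? i) (P⊆Q i p)))

count-∪ : ∀ {n} {P Q R : Fin n → Set} (P? : ∀ i → Dec (P i)) (Q? : ∀ i → Dec (Q i)) (R? : ∀ i → Dec (R i)) →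
          (∀ i → R i → P i ⊎ Q i) → count R? ≤ count P? + count Q?
count-∪ P? Q? R? cover = ≤-trans (sum-mono pointwise)
  (≤-reflexive (∑-distrib-+ (λ i → χ (does (P? i))) (λ i → χ (does (Q? i)))))
  where
  pointwise : ∀ i → χ (does (R? i)) ≤ χ (does (P? i)) + χ (does (Q? i))
  pointwise i = χ-≤ (R? i) λ r → case cover i r of λ where
    (inj₁ p) → ≤-trans (≤-reflexive (sym (χ-yes (P? i) p))) (m≤m+n _ _)
    (inj₂ q) → ≤-trans (≤-reflexive (sym (χ-yes (Q? i) q))) (m≤n+m _ _)

count-all : ∀ {n} {P : Fin n → Set} (P? : ∀ i → Dec (P i)) → (∀ i → P i) → n ≤ count P?
count-all {zero}  P? all = z≤n
count-all {suc n} P? all = +-mono-≤ (≤-reflexive (sym (χ-yes (P? Fin.zero) (all Fin.zero)))) (count-all (P? ∘ Fin.suc) (all ∘ Fin.suc))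

-- Selections of darts and the counting inequality that rules out universal failure.

single : ∀ {n} → (Fin n → Bool → Bool) → Fin n → Bool
single P u = P u true xor P u false

double : ∀ {n} → (Fin n → Bool → Bool) → Fin n → Bool
double P u = P u true ∧ P u false

#single #double #support #total : ∀ {n} → (Fin n → Bool → Bool) → ℕ
#single  P = sum (λ u → χ (single P u))
#double  P = sum (λ u → χ (double P u))
#support P = sum (λ u → χ (P u true ∨ P u false))
#total   P = sum (λ u → χ (P u true) + χ (P u false))

support-split : ∀ {n} (P : Fin n → Bool → Bool) → #support P ≡ #single P + #double P
support-split P = trans (sum-cong-≗ (λ u → pt (P u true) (P u false)))
  (∑-distrib-+ (λ u → χ (single P u)) (λ u → χ (double P u)))
  where
  pt : ∀ a b → χ (a ∨ b) ≡ χ (a xor b) + χ (a ∧ b)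
  pt true  true  = refl
  pt true  false = refl
  pt false true  = refl
  pt false false = refl

total-split : ∀ {n} (P : Fin n → Bool → Bool) → #total P ≡ #single P + (#double P + #double P)
total-split P = trans (sum-cong-≗ (λ u → pt (P u true) (P u false)))
  (trans (∑-distrib-+ (λ u → χ (single P u)) (λ u → χ (double P u) + χ (double P u)))
         (cong (#single P +_) (∑-distrib-+ (λ u → χ (double P u)) (λ u → χ (double P u)))))
  where
  pt : ∀ a b → χ a + χ b ≡ χ (a xor b) + (χ (a ∧ b) + χ (a ∧ b))
  pt true  true  = refl
  pt true  false = refl
  pt false true  = refl
  pt false false = refl

sum-χ-bound : ∀ {n} (f : Fin n → ℕ) (g : Fin n → Fin n → ℕ) {k} → (∀ u → sum (g u) ≤ k) →
              sum (λ u → sum (λ w → f u * g u w)) ≤ k * sum f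
sum-χ-bound f g {k} g≤k = begin
  sum (λ u → sum (λ w → f u * g u w)) ≡⟨ sum-cong-≗ (λ u → *-distribˡ-sum (f u) (g u)) ⟨
  sum (λ u → f u * sum (g u))         ≤⟨ sum-mono (λ u → *-monoʳ-≤ (f u) (g≤k u)) ⟩
  sum (λ u → f u * k)                 ≡⟨ *-distribʳ-sum k f ⟨
  sum f * k                           ≡⟨ *-comm (sum f) k ⟩
  k * sum f                           ∎
  where open ≤-Reasoning

-- Each pair of supported vertices is charged to one cause of failure. A single `u` has one
-- forbidden colour, met at most `k` times in its row; likewise a single `w` in its column; and `u`
-- has at most `ε` near vertices.
support-product : ∀ {n k ε} (c : Fin n → Fin n → ℕ) (P Q : Fin n → Bool → Bool) (α β : Fin n → ℕ)
  (near : Fin n → Fin n → Bool) →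
  (∀ u γ → count (λ w → c u w ≟ γ) ≤ k) →
  (∀ w γ → count (λ u → c u w ≟ γ) ≤ k) →
  (∀ u → sum (λ w → χ (near u w)) ≤ ε) →
  (∀ u w → P u true ∨ P u false ≡ true → Q w true ∨ Q w false ≡ true →
     (single P u ≡ true × c u w ≡ α u) ⊎ (single Q w ≡ true × c u w ≡ β w) ⊎ near u w ≡ true) →
  #support P * #support Q ≤ k * #single P + k * #single Q + ε * #support P
support-product {n} {k} {ε} c P Q α β near rows cols nears blocked = begin
  #support P * #support Q
    ≡⟨ *-distribʳ-sum (#support Q) sP ⟩
  sum (λ u → sP u * sum sQ)
    ≡⟨ sum-cong-≗ (λ u → *-distribˡ-sum (sP u) sQ) ⟩
  sum (λ u → sum (λ w → sP u * sQ w))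
    ≤⟨ sum-mono (λ u → sum-mono (λ w → pointwise u w)) ⟩
  sum (λ u → sum (λ w → F u w + G u w + N u w))
    ≡⟨ sum-cong-≗ (λ u → trans (∑-distrib-+ (λ w → F u w + G u w) (N u)) (cong (_+ sum (N u)) (∑-distrib-+ (F u) (G u)))) ⟩
  sum (λ u → sum (F u) + sum (G u) + sum (N u))
    ≡⟨ trans (∑-distrib-+ (λ u → sum (F u) + sum (G u)) (λ u → sum (N u)))
             (cong (_+ sum (λ u → sum (N u))) (∑-distrib-+ (λ u → sum (F u)) (λ u → sum (G u)))) ⟩
  sum (λ u → sum (F u)) + sum (λ u → sum (G u)) + sum (λ u → sum (N u))
    ≡⟨ cong (λ z → sum (λ u → sum (F u)) + z + sum (λ u → sum (N u))) (∑-comm G) ⟩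
  sum (λ u → sum (F u)) + sum (λ w → sum (λ u → G u w)) + sum (λ u → sum (N u))
    ≤⟨ +-mono-≤ (+-mono-≤ (sum-χ-bound (λ u → χ (single P u)) _ (λ u → rows u (α u)))
                          (sum-χ-bound (λ w → χ (single Q w)) _ (λ w → cols w (β w))))
                (sum-χ-bound sP _ nears) ⟩
  k * #single P + k * #single Q + ε * #support P ∎
  where
  open ≤-Reasoning
  sP sQ : Fin n → ℕ
  sP u = χ (P u true ∨ P u false)
  sQ w = χ (Q w true ∨ Q w false)
  F G N : Fin n → Fin n → ℕ
  F u w = χ (single P u) * χ (does (c u w ≟ α u))
  G u w = χ (single Q w) * χ (does (c u w ≟ β w))
  N u w = sP u * χ (near u w)
  pointwise : ∀ u w → sP u * sQ w ≤ F u w + G u w + N u w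
  pointwise u w with P u true ∨ P u false in eP
  ... | false = z≤n
  ... | true with Q w true ∨ Q w false in eQ
  ...   | false = z≤n
  ...   | true with blocked u w eP eQ
  ...     | inj₁ (s , e) rewrite s = ≤-trans (≤-reflexive (sym (trans (+-identityʳ _) (χ-yes (c u w ≟ α u) e))))
                                       (≤-trans (m≤m+n _ _) (m≤m+n _ _))
  ...     | inj₂ (inj₁ (s , e)) rewrite s = ≤-trans (≤-reflexive (sym (trans (+-identityʳ _) (χ-yes (c u w ≟ β w) e))))
                                       (≤-trans (m≤n+m _ (F u w)) (m≤m+n _ (χ (near u w) + 0)))
  ...     | inj₂ (inj₂ e) rewrite e = m≤n+m 1 _

private
  no-room : ∀ {a b} → a + b ≤ a → 1 ≤ b → ⊥
  no-room {a} {b} le p = <-irrefl refl (≤-trans (≤-trans (≤-reflexive (+-comm 1 a)) (+-monoʳ-≤ a p)) le)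

-- b and a (resp. f and g) count the vertices with exactly one and with two edges in P (resp. Q), so
-- |P| = b + 2a and |Q| = f + 2g; ε bounds the number of vertices near a given one.
support-contradiction : ∀ {k ε δ} (b a f g : ℕ) → 1 ≤ k → 1 ≤ δ → ε ≤ suc δ →
  2 * k + ε + δ ≤ b + (a + a) → 2 * k + ε + δ ≤ f + (g + g) → b + a ≤ f + g →
  (b + a) * (f + g) ≤ k * b + k * f + ε * (b + a) → ⊥
support-contradiction {k} {ε} {δ} b a f g 1≤k 1≤δ ε≤ m≤p m≤q A≤B ineq
  = cases (≤-total m B)
  where
  open ≤-Reasoning
  m A B : ℕ
  m = 2 * k + ε + δ
  A = b + a
  B = f + g

  twice : ∀ b a → b + (b + (a + a)) ≡ 2 * (b + a)
  twice = solve-∀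

  -- From `m ≤ b + 2a` follows `b ≤ 2A - m`; this is `k` times that bound, written without
  -- subtraction. The same is done for `f` below.
  kb : k * b + k * m ≤ 2 * k * A
  kb = begin
    k * b + k * m             ≤⟨ +-monoʳ-≤ (k * b) (*-monoʳ-≤ k m≤p) ⟩
    k * b + k * (b + (a + a)) ≡⟨ e k b a ⟩
    2 * k * A                 ∎
    where
    e : ∀ k b a → k * b + k * (b + (a + a)) ≡ 2 * k * (b + a)
    e = solve-∀

  kf : k * f + k * m ≤ 2 * k * B
  kf = begin
    k * f + k * m             ≤⟨ +-monoʳ-≤ (k * f) (*-monoʳ-≤ k m≤q) ⟩
    k * f + k * (f + (g + g)) ≡⟨ e k f g ⟩
    2 * k * B                 ∎
    where
    e : ∀ k b a → k * b + k * (b + (a + a)) ≡ 2 * k * (b + a)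
    e = solve-∀

  m≤2A : m ≤ 2 * A
  m≤2A = ≤-trans m≤p (≤-trans (m≤n+m _ b) (≤-reflexive (twice b a)))

  1≤kδ : 1 ≤ k * δ
  1≤kδ = *-mono-≤ 1≤k 1≤δ

  -- Case `B ≥ m`, with `B = m + r` and `A = k + A₁`: bounding `f` by `B` and `b` by `2A - m`, the
  -- inequality fails by the positive amount `kδ + A₁(δ + r)`.
  big : ∀ r A₁ → m + r ≡ B → k + A₁ ≡ A → ⊥
  big r A₁ eB eA = no-room {b = k * δ + A₁ * (δ + r)} (begin
    2 * k * A + k * B + ε * A + (k * δ + A₁ * (δ + r))
      ≡⟨ cong₂ (λ x y → 2 * k * x + k * y + ε * x + (k * δ + A₁ * (δ + r))) (sym eA) (sym eB) ⟩
    2 * k * (k + A₁) + k * (m + r) + ε * (k + A₁) + (k * δ + A₁ * (δ + r))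
      ≡⟨ e k ε δ r A₁ ⟩
    (k + A₁) * (m + r) + k * m
      ≡⟨ cong₂ (λ x y → x * y + k * m) eA eB ⟩
    A * B + k * m
      ≤⟨ +-monoˡ-≤ (k * m) ineq ⟩
    k * b + k * f + ε * A + k * m
      ≡⟨ e₂ (k * b) (k * f) (ε * A) (k * m) ⟩
    k * b + k * m + k * f + ε * A
      ≤⟨ +-monoˡ-≤ (ε * A) (+-mono-≤ kb (*-monoʳ-≤ k (m≤m+n f g))) ⟩
    2 * k * A + k * B + ε * A ∎)
    (≤-trans 1≤kδ (m≤m+n _ _))
    where
    e : ∀ k ε δ r A₁ → 2 * k * (k + A₁) + k * (2 * k + ε + δ + r) + ε * (k + A₁) + (k * δ + A₁ * (δ + r))
        ≡ (k + A₁) * (2 * k + ε + δ + r) + k * (2 * k + ε + δ)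
    e = solve-∀
    e₂ : ∀ x y z w → x + y + z + w ≡ x + w + y + z
    e₂ = solve-∀

  -- Case `B ≤ m`, with `z = m - B`, `x = B - A` and `w = 2A - m`. Eliminating `b` and `f` leaves
  -- `main`, where `x + w = A + B - m`.
  small : ∀ x w z → z + x + w ≡ A → z + 2 * x + w ≡ B → 2 * z + 2 * x + w ≡ m → ⊥
  small x w z eA eB em = final (≤-total ε (z + x))
    where
    main : δ * (x + w) + (z + x) * z ≤ ε * z
    main = +-cancelˡ-≤ ((2 * k + ε) * (x + w) + 2 * k * m) _ _ (begin
      (2 * k + ε) * (x + w) + 2 * k * m + (δ * (x + w) + (z + x) * z)
        ≡⟨ e₁ k ε δ x w z ⟩
      m * (x + w) + (z + x) * z + 2 * k * m
        ≡⟨ cong (λ y → y * (x + w) + (z + x) * z + 2 * k * m) em ⟨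
      (2 * z + 2 * x + w) * (x + w) + (z + x) * z + 2 * k * m
        ≡⟨ cong (_+ 2 * k * m) (e₂ x w z) ⟩
      (z + x + w) * (z + 2 * x + w) + 2 * k * m
        ≡⟨ cong₂ (λ y y′ → y * y′ + 2 * k * m) eA eB ⟩
      A * B + 2 * k * m
        ≤⟨ +-monoˡ-≤ (2 * k * m) ineq ⟩
      k * b + k * f + ε * A + 2 * k * m
        ≡⟨ e₃ (k * b) (k * f) (ε * A) k m ⟩
      (k * b + k * m) + (k * f + k * m) + ε * A
        ≤⟨ +-monoˡ-≤ (ε * A) (+-mono-≤ kb kf) ⟩
      2 * k * A + 2 * k * B + ε * A
        ≡⟨ cong₂ (λ y y′ → 2 * k * y + 2 * k * y′ + ε * y) eA eB ⟨
      2 * k * (z + x + w) + 2 * k * (z + 2 * x + w) + ε * (z + x + w)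
        ≡⟨ e₄ k ε x w z ⟩
      (2 * k + ε) * (x + w) + 2 * k * (2 * z + 2 * x + w) + ε * z
        ≡⟨ cong (λ y → (2 * k + ε) * (x + w) + 2 * k * y + ε * z) em ⟩
      (2 * k + ε) * (x + w) + 2 * k * m + ε * z ∎)
      where
      e₁ : ∀ k ε δ x w z → (2 * k + ε) * (x + w) + 2 * k * (2 * k + ε + δ) + (δ * (x + w) + (z + x) * z)
           ≡ (2 * k + ε + δ) * (x + w) + (z + x) * z + 2 * k * (2 * k + ε + δ)
      e₁ = solve-∀
      e₂ : ∀ x w z → (2 * z + 2 * x + w) * (x + w) + (z + x) * z ≡ (z + x + w) * (z + 2 * x + w)
      e₂ = solve-∀
      e₃ : ∀ s t u k m → s + t + u + 2 * k * m ≡ s + k * m + (t + k * m) + u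
      e₃ = solve-∀
      e₄ : ∀ k ε x w z → 2 * k * (z + x + w) + 2 * k * (z + 2 * x + w) + ε * (z + x + w)
           ≡ (2 * k + ε) * (x + w) + 2 * k * (2 * z + 2 * x + w) + ε * z
      e₄ = solve-∀

    -- Here `A = B = z` and `m = 2z`. For positive `z`, `main` gives `z ≤ ε ≤ δ + 1`, so `2 + 2z ≤
    -- 2k + ε + (δ + 1) = m + 1 = 2z + 1`.
    narrow : ε ≤ z + x → x + w ≡ 0 → ⊥
    narrow ε≤y xw0 with m+n≡0⇒m≡0 x xw0 | m+n≡0⇒n≡0 x xw0
    ... | refl | refl = byz z refl
      where
      byz : ∀ z₀ → z₀ ≡ z → ⊥
      byz zero refl with m+n≡0⇒n≡0 (2 * k + ε) (sym em)
      ... | refl = <⇒≱ 1≤δ z≤n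
      byz (suc z₀) refl = 1+n≰n {suc (2 * z)} (begin
          suc (suc (2 * z))       ≡⟨ e z ⟩
          2 + z + z               ≤⟨ +-mono-≤ (+-mono-≤ (*-monoʳ-≤ 2 1≤k) z≤ε) (≤-trans z≤ε ε≤) ⟩
          2 * k + ε + suc δ       ≡⟨ +-suc _ δ ⟩
          suc m                   ≡⟨ cong (1 +_) em ⟨
          suc (2 * z + 2 * 0 + 0) ≡⟨ e′ z ⟩
          suc (2 * z)             ∎)
        where
        e : ∀ z → suc (suc (2 * z)) ≡ 2 + z + z
        e z = cong (λ y → 2 + (z + y)) (+-identityʳ z)
        e′ : ∀ z → suc (2 * z + 2 * 0 + 0) ≡ suc (2 * z)
        e′ z = cong (1 +_) (trans (+-identityʳ (2 * z + 0)) (+-identityʳ (2 * z)))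
        z≤ε : z ≤ ε
        z≤ε = *-cancelʳ-≤ z ε z (≤-trans (≤-reflexive (cong (_* z) (sym (+-identityʳ z)))) (≤-trans (m≤n+m _ _) main))

    low : ε ≤ z + x → ⊥
    low ε≤y = byxw (x + w) refl
      where
      byxw : ∀ l → l ≡ x + w → ⊥
      byxw zero    eq = narrow ε≤y (sym eq)
      byxw (suc l) eq = no-room {(z + x) * z} (begin
        (z + x) * z + δ * (x + w) ≡⟨ +-comm ((z + x) * z) _ ⟩
        δ * (x + w) + (z + x) * z ≤⟨ main ⟩
        ε * z                     ≤⟨ *-monoˡ-≤ z ε≤y ⟩
        (z + x) * z               ∎)
        (*-mono-≤ 1≤δ (≤-trans (s≤s z≤n) (≤-reflexive eq)))

    -- Now `e = ε - (z + x) - 1` and `d = δ - z`, where `z ≤ δ` because `z < ε ≤ δ + 1`. Then `main`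
    -- gives `δ(x + w) ≤ (e + 1)δ`, whereas `x + w = e + 1 + 2k + d`.
    high : ∀ e d → suc (z + x) + e ≡ ε → z + d ≡ δ → ⊥
    high e d eε eδ = no-room {δ * suc e} (begin
      δ * suc e + δ * (2 * k + d) ≡⟨ *-distribˡ-+ δ (suc e) (2 * k + d) ⟨
      δ * (suc e + (2 * k + d))   ≡⟨ cong (δ *_) xw ⟨
      δ * (x + w)                 ≤⟨ δxw≤ ⟩
      suc e * z                   ≤⟨ *-monoʳ-≤ (suc e) (≤-trans (m≤m+n z d) (≤-reflexive eδ)) ⟩
      suc e * δ                   ≡⟨ *-comm (suc e) δ ⟩
      δ * suc e                   ∎)
      (*-mono-≤ 1≤δ (≤-trans 1≤k (≤-trans (m≤m+n k _) (m≤m+n (2 * k) d))))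
      where
      xw : x + w ≡ suc e + (2 * k + d)
      xw = +-cancelˡ-≡ (2 * z + x) _ _ (begin-equality
        2 * z + x + (x + w)                   ≡⟨ e₁ x w z ⟩
        2 * z + 2 * x + w                     ≡⟨ em ⟩
        2 * k + ε + δ                         ≡⟨ cong₂ (λ p q → 2 * k + p + q) eε eδ ⟨
        2 * k + (suc (z + x) + e) + (z + d)   ≡⟨ e₂ k x z e d ⟩
        2 * z + x + (suc e + (2 * k + d))     ∎)
        where
        e₁ : ∀ x w z → 2 * z + x + (x + w) ≡ 2 * z + 2 * x + w
        e₁ = solve-∀
        e₂ : ∀ k x z e d → 2 * k + (suc (z + x) + e) + (z + d) ≡ 2 * z + x + (suc e + (2 * k + d))
        e₂ = solve-∀
      δxw≤ : δ * (x + w) ≤ suc e * z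
      δxw≤ = +-cancelʳ-≤ ((z + x) * z) _ _ (begin
        δ * (x + w) + (z + x) * z  ≤⟨ main ⟩
        ε * z                      ≡⟨ cong (_* z) eε ⟨
        (suc (z + x) + e) * z      ≡⟨ e₃ x z e ⟩
        suc e * z + (z + x) * z    ∎)
        where
        e₃ : ∀ x z e → (suc (z + x) + e) * z ≡ suc e * z + (z + x) * z
        e₃ = solve-∀

    final : ε ≤ z + x ⊎ z + x ≤ ε → ⊥
    final (inj₁ ε≤y) = low ε≤y
    final (inj₂ y≤ε) with m≤n⇒m<n∨m≡n y≤ε
    ... | inj₂ y≡ε = low (≤-reflexive (sym y≡ε))
    ... | inj₁ y<ε with m≤n⇒∃[o]m+o≡n y<ε | m≤n⇒∃[o]m+o≡n (≤-trans (m≤m+n z x) (s≤s⁻¹ (≤-trans y<ε ε≤)))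
    ...   | e , eε | d , eδ = high e d eε eδ

  cases : m ≤ B ⊎ B ≤ m → ⊥
  cases (inj₁ m≤B) with m≤n⇒∃[o]m+o≡n m≤B | m≤n⇒∃[o]m+o≡n k≤A
    where
    k≤A : k ≤ A
    k≤A = *-cancelˡ-≤ 2 (≤-trans (≤-trans (m≤m+n (2 * k) ε) (m≤m+n _ δ)) m≤2A)
  ... | r , eB | A₁ , eA = big r A₁ eB eA
  cases (inj₂ B≤m) with m≤n⇒∃[o]m+o≡n B≤m
  ... | z , ez with m≤n⇒∃[o]m+o≡n A+z≤m
    where
    A+z≤m : A + z ≤ m
    A+z≤m = ≤-trans (+-monoˡ-≤ z A≤B) (≤-reflexive ez)
  ...   | x , ex with m≤n⇒∃[o]m+o≡n y≤A
    where
    y≤A : z + x ≤ A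
    y≤A = +-cancelˡ-≤ A _ _ (begin
      A + (z + x) ≡⟨ +-assoc A z x ⟨
      A + z + x   ≡⟨ ex ⟩
      m           ≤⟨ m≤2A ⟩
      2 * A       ≡⟨ cong (A +_) (+-identityʳ A) ⟩
      A + A       ∎)
  ...     | w , ew = small x w z ew eB em
    where
    em : 2 * z + 2 * x + w ≡ m
    em = begin-equality
      2 * z + 2 * x + w   ≡⟨ e x w z ⟩
      z + x + w + z + x   ≡⟨ cong (λ y → y + z + x) ew ⟩
      A + z + x           ≡⟨ ex ⟩
      m ∎
      where
      e : ∀ x w z → 2 * z + 2 * x + w ≡ z + x + w + z + x
      e = solve-∀
    eB : z + 2 * x + w ≡ B
    eB = +-cancelʳ-≡ z _ _ (begin-equality
      z + 2 * x + w + z ≡⟨ e x w z ⟩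
      2 * z + 2 * x + w ≡⟨ em ⟩
      m                 ≡⟨ ez ⟨
      B + z             ∎)
      where
      e : ∀ x w z → z + 2 * x + w + z ≡ 2 * z + 2 * x + w
      e = solve-∀

-- Decidability, the vertices opposite a given one, and neighbourhoods along the cycles.

_≟ⱽ_ : ∀ {n} (u v : V n) → Dec (u ≡ v)
_≟ⱽ_ = Sum.≡-dec Fin._≟_ Fin._≟_

_≟ᴰ_ : ∀ {n} (s s′ : Dart n) → Dec (s ≡ s′)
_≟ᴰ_ = Product.≡-dec _≟ⱽ_ Bool._≟_

_∈?_ : ∀ {n} (v : V n) (vs : List (V n)) → Dec (v ∈ vs)
v ∈? vs = Any.any? (v ≟ⱽ_) vs

-- Lets counts at left and at right vertices be treated alike.
opp : ∀ {n} → V n → Fin n → V n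
opp (inj₁ _) = inj₂
opp (inj₂ _) = inj₁

opp-injective : ∀ {n} (z : V n) {i j} → opp z i ≡ opp z j → i ≡ j
opp-injective (inj₁ _) = inj₂-injective
opp-injective (inj₂ _) = inj₁-injective

side-opp : ∀ {n} (z : V n) j → side (opp z j) ≡ not (side z)
side-opp (inj₁ _) j = refl
side-opp (inj₂ _) j = refl

left-index : ∀ {n} (v : V n) → side v ≡ true → ∃ λ u → inj₁ u ≡ v
left-index (inj₁ u) _ = u , refl

right-index : ∀ {n} (v : V n) → side v ≡ false → ∃ λ u → inj₂ u ≡ v
right-index (inj₂ u) _ = u , refl

col-sym : ∀ {n} (c : Coloring n) u v → col c u v ≡ col c v u
col-sym c (inj₁ _) (inj₁ _) = refl
col-sym c (inj₁ _) (inj₂ _) = refl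
col-sym c (inj₂ _) (inj₁ _) = refl
col-sym c (inj₂ _) (inj₂ _) = refl

count-∈ : ∀ {n} (z : V n) (vs : List (V n)) → count (λ j → opp z j ∈? vs) ≤ length vs
count-∈ {n} z []   = ≤-reflexive (sum-zero {n} _ λ _ → refl)
count-∈ z (v ∷ vs) = ≤-trans
  (count-∪ (λ j → opp z j ≟ⱽ v) (λ j → opp z j ∈? vs) (λ j → opp z j ∈? (v ∷ vs))
    λ { j (here p) → inj₁ p ; j (there q) → inj₂ q })
  (+-mono-≤ (count≤1 (λ j → opp z j ≟ⱽ v) λ i j p q → opp-injective z (trans p (sym q))) (count-∈ z vs))

parity : ∀ i → ∃ λ l → i ≡ l * 2 ⊎ i ≡ suc (l * 2)
parity zero = 0 , inj₁ refl
parity (suc i) with parity i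
... | l , inj₁ refl = l , inj₂ refl
... | l , inj₂ refl = suc l , inj₁ refl

∃Bool? : ∀ {P : Bool → Set} → (∀ b → Dec (P b)) → Dec (∃ P)
∃Bool? P? = map′ (λ { (inj₁ p) → true , p ; (inj₂ p) → false , p })
                 (λ { (true , p) → inj₁ p ; (false , p) → inj₂ p })
                 (P? true ⊎-dec P? false)

clash : ∀ {n} {s s′ : Dart n} → s ≡ s′ → side (vtx s) ≡ not (side (vtx s′)) → ⊥
clash refl = not-¬ refl

module Near {n : ℕ} (h : ℕ) (H : TwoRegular n) where
  open Walk H

  -- Positions 3, 5, ..., 2h+1 on the two walks from `z`, all on the opposite side. Position 1 is
  -- left out: other conditions exclude the neighbours of `z`, and the list keeps length `2 * h`.
  near : V n → List (V n)
  near z = map (λ l → vtx (walk (suc (suc l * 2)) (z , true))) (upTo h)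
        ++ map (λ l → vtx (walk (suc (suc l * 2)) (z , false))) (upTo h)

  length-near : ∀ z → length (near z) ≡ 2 * h
  length-near z = begin
    length (near z)                                      ≡⟨ length-++ (map _ (upTo h)) ⟩
    length (map _ (upTo h)) + length (map _ (upTo h))    ≡⟨ cong₂ _+_ (length-map _ (upTo h)) (length-map _ (upTo h)) ⟩
    length (upTo h) + length (upTo h)                    ≡⟨ cong (λ m → m + m) (length-upTo h) ⟩
    h + h                                                ≡⟨ cong (h +_) (+-identityʳ h) ⟨
    2 * h                                                ∎
    where open ≡-Reasoning

  near-intro : ∀ s l → l < h → vtx (walk (suc (suc l * 2)) s) ∈ near (vtx s)
  near-intro (z , true)  l l<h = ∈-++⁺ˡ (∈-map⁺ _ (∈-upTo⁺ l<h))
  near-intro (z , false) l l<h = ∈-++⁺ʳ (map _ (upTo h)) (∈-map⁺ _ (∈-upTo⁺ l<h))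

  near-elim : ∀ z {v} → v ∈ near z → ∃ λ b → ∃ λ l → l < h × v ≡ vtx (walk (suc (suc l * 2)) (z , b))
  near-elim z v∈ with ∈-++⁻ (map _ (upTo h)) v∈
  ... | inj₁ p = let l , l∈ , e = ∈-map⁻ _ p in true  , l , ∈-upTo⁻ l∈ , e
  ... | inj₂ p = let l , l∈ , e = ∈-map⁻ _ p in false , l , ∈-upTo⁻ l∈ , e

  near-sym : ∀ {u v} → v ∈ near u → u ∈ near v
  near-sym {u} {v} v∈ with near-elim u v∈
  ... | b , l , l<h , refl =
    subst (_∈ near v) (cong vtx (walk-flip (suc (suc l * 2)) (u , b)))
          (near-intro (flip (walk (suc (suc l * 2)) (u , b))) l l<h)

  -- The odd positions 3, 5, …, 2h+1 of the two walks leaving d cover all edges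
  -- within distance 2h, apart from the two neighbours of d excluded separately.
  far-if : ∀ d d′ → side (vtx d′) ≡ side (vtx d) → vtx (rev d′) ∉ near (vtx d) →
           rev d′ ≢ flip (rev d) → vtx (rev d′) ≢ vtx (rev (flip d)) → Far h d d′
  far-if d d′ same ¬near ≢₁ ≢₂ i 1≤i i≤ with parity i
  far-if d d′ same ¬near ≢₁ ≢₂ i 1≤i i≤ | zero , inj₁ refl = ⊥-elim (<⇒≱ 1≤i z≤n)
  far-if d d′ same ¬near ≢₁ ≢₂ i 1≤i i≤ | suc l , inj₁ refl =
    -- Parity rules out two of the four encounters. If `d` reaches `d′`, one more step reaches the
    -- vertex of `rev d′` at an odd position. If `rev d` reaches `rev d′`, its first step is to
    -- `flip d`, which leaves an odd position on the other walk.
    ( (λ eq → ¬near (subst (_∈ near (vtx d)) (cong vtx (trans (walk-suc (suc l * 2) d) (cong σ eq)))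
                           (near-intro d l l<h)))
    , (λ eq → clash eq (trans (side-walk-even (suc l) d)
                         (trans (sym same) (trans (sym (not-involutive _)) (cong not (sym (crossing d′))))))) )
    , ( (λ eq → clash eq (trans (side-walk-even (suc l) (rev d)) (trans (crossing d) (cong not (sym same)))))
      , back l l<h )
    where
    l<h : l < h
    l<h = *-cancelʳ-≤ (suc l) h 2 i≤
    back : ∀ l → l < h → walk (suc l * 2) (rev d) ≢ rev d′
    back zero    _   eq = ≢₂ (cong vtx (trans (sym eq) (cong σ (σ-rev d))))
    back (suc l) l<h eq = ¬near (subst (_∈ near (vtx d))
      (cong vtx (trans (cong (walk (suc (suc l * 2))) (sym (σ-rev d))) eq))
      (near-intro (flip d) l (<⇒≤ l<h)))
  far-if d d′ same ¬near ≢₁ ≢₂ i 1≤i i≤ | l , inj₂ refl =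
    ( (λ eq → clash eq (trans (side-walk-odd l d) (cong not (sym same))))
    , forth l l<h )
    , ( back l l<h
      , (λ eq → clash eq (trans (side-walk-odd l (rev d))
                           (cong not (trans (crossing d) (trans (cong not (sym same)) (sym (crossing d′))))))) )
    where
    l<h : l < h
    l<h = *-cancelʳ-< 2 l h i≤
    forth : ∀ l → l < h → walk (suc (l * 2)) d ≢ rev d′
    forth zero    _   eq = ≢₁ (sym eq)
    forth (suc l) l<h eq = ¬near (subst (_∈ near (vtx d)) (cong vtx eq) (near-intro d l (<⇒≤ l<h)))
    back : ∀ l → l < h → walk (suc (l * 2)) (rev d) ≢ d′
    back zero    _   eq = ≢₂ (cong (vtx ∘ rev) (trans (sym eq) (σ-rev d)))
    back (suc l) l<h eq = ¬near (subst (_∈ near (vtx d))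
      (cong vtx (begin
        walk (suc (suc l * 2)) (flip d)        ≡⟨ cong (walk (suc (suc l * 2))) (sym (σ-rev d)) ⟩
        walk (suc (suc l * 2)) (σ (rev d))     ≡⟨ walk-suc (suc (suc l * 2)) (rev d) ⟩
        σ (walk (suc (suc l * 2)) (rev d))     ≡⟨ cong σ eq ⟩
        σ d′                                   ∎))
      (near-intro (flip d) l (<⇒≤ l<h)))
      where open ≡-Reasoning

-- Exchanging edges, and what an exchange must satisfy to preserve a factor.

swap : ∀ {n} → Dart n → Dart n → Dart n → Dart n
swap p q s = if does (s ≟ᴰ p) then q else if does (s ≟ᴰ q) then p else s

swap-left : ∀ {n} (p q : Dart n) → swap p q p ≡ q
swap-left p q rewrite dec-true (p ≟ᴰ p) refl = refl

swap-other : ∀ {n} {p q s : Dart n} → s ≢ p → s ≢ q → swap p q s ≡ s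
swap-other {p = p} {q} {s} s≢p s≢q rewrite dec-false (s ≟ᴰ p) s≢p | dec-false (s ≟ᴰ q) s≢q = refl

swap-right : ∀ {n} (p q : Dart n) → swap p q q ≡ p
swap-right p q with q ≟ᴰ p
... | yes refl = refl
... | no _ rewrite dec-true (q ≟ᴰ q) refl = refl

swap-involutive : ∀ {n} (p q s : Dart n) → swap p q (swap p q s) ≡ s
swap-involutive p q s with s ≟ᴰ p
... | yes refl = swap-right p q
... | no s≢p with s ≟ᴰ q
...   | yes refl = swap-left p q
...   | no s≢q = swap-other s≢p s≢q

side-swap : ∀ {n} (p q s : Dart n) → side (vtx p) ≡ side (vtx q) → side (vtx (swap p q s)) ≡ side (vtx s)
side-swap p q s eq with s ≟ᴰ p
... | yes refl = sym eq
... | no s≢p with s ≟ᴰ q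
...   | yes refl = eq
...   | no s≢q = refl

-- Conjugating `rev` by the transposition of `p` and `q` yields an involution at once; in effect the
-- edges at `p` and `q` trade their far ends.
module Switch {n} (H : TwoRegular n) (p q : Dart n) (eq : side (vtx p) ≡ side (vtx q)) where
  open Walk H

  abstract
    switch : TwoRegular n
    switch = record
      { rev        = λ s → swap p q (rev (swap p q s))
      ; involutive = λ s → trans (cong (swap p q ∘ rev) (swap-involutive p q (rev (swap p q s))))
                          (trans (cong (swap p q) (involutive (swap p q s))) (swap-involutive p q s))
      ; crossing   = λ s → trans (side-swap p q (rev (swap p q s)) eq)
                          (trans (crossing (swap p q s)) (cong not (side-swap p q s eq)))
      }

    switch-left : TwoRegular.rev switch p ≡ rev q
    switch-left = trans (cong (swap p q ∘ rev) (swap-left p q))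
      (swap-other (λ e → clash e (trans (crossing q) (cong not (sym eq)))) (rev≢ q))

    switch-right : TwoRegular.rev switch q ≡ rev p
    switch-right = trans (cong (swap p q ∘ rev) (swap-right p q))
      (swap-other (rev≢ p) (λ e → clash e (trans (crossing p) (cong not eq))))

    switch-other : ∀ {s} → s ≢ p → s ≢ q → rev s ≢ p → rev s ≢ q → TwoRegular.rev switch s ≡ rev s
    switch-other s≢p s≢q r≢p r≢q = trans (cong (swap p q ∘ rev) (swap-other s≢p s≢q)) (swap-other r≢p r≢q)

ecol : ∀ {n} → Coloring n → TwoRegular n → Dart n → ℕ
ecol c H s = col c (vtx s) (vtx (TwoRegular.rev H s))

Proper : ∀ {n} → Coloring n → TwoRegular n → Set
Proper c H = ∀ s → ecol c H (flip s) ≢ ecol c H s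

Factor : ∀ {n} → ℕ → Coloring n → Set
Factor {n} h c = Σ (TwoRegular n) λ H → Proper c H × Walk.Long H h

module Exchange {n} (h : ℕ) (c : Coloring n) (H H′ : TwoRegular n) (ds : List (Dart n)) where
  open Walk H
  rev′ : Dart n → Dart n
  rev′ = TwoRegular.rev H′

  Apart : Dart n → Dart n → Set
  Apart d d′ = vtx d ≢ vtx d′ × vtx (rev d) ≢ vtx (rev d′)

  Left : Dart n → Set
  Left d = side (vtx d) ≡ true

  -- `flip s` carries the edge kept at `vtx s`, so the last condition is properness at `vtx s` after
  -- the exchange.
  Good : Dart n → Dart n → Set
  Good s s′ = rev′ s ≡ s′ × On ds s′ × col c (vtx s) (vtx s′) ≢ ecol c H (flip s)

  On? : ∀ s → Dec (On ds s)
  On? s = Any.any? (λ d → (s ≟ᴰ d) ⊎-dec (s ≟ᴰ rev d)) ds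

  left≢right : ∀ d d′ → Left d → Left d′ → vtx d ≢ vtx (rev d′)
  left≢right d d′ l l′ e = not-¬ refl (trans (sym l′) (trans (sym (not-involutive _))
    (cong not (trans (sym (crossing d′)) (trans (cong side (sym e)) l)))))

  OnEdge-flip : ∀ {s d} → Left d → OnEdge s d → ¬ OnEdge (flip s) d
  OnEdge-flip         l (inj₁ refl) (inj₁ e) = flip≢ _ e
  OnEdge-flip {d = d} l (inj₁ refl) (inj₂ e) = left≢right d d l l (cong vtx e)
  OnEdge-flip {d = d} l (inj₂ refl) (inj₁ e) = left≢right d d l l (cong vtx (sym e))
  OnEdge-flip         l (inj₂ refl) (inj₂ e) = flip≢ _ e

  OnEdge-apart : ∀ {s d d′} → Left d → Left d′ → Apart d d′ → OnEdge s d → ¬ OnEdge (flip s) d′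
  OnEdge-apart l l′ (≢₁ , ≢₂) (inj₁ refl) (inj₁ e) = ≢₁ (cong vtx e)
  OnEdge-apart {_} {d} {d′} l l′ _ (inj₁ refl) (inj₂ e) = left≢right d d′ l l′ (cong vtx e)
  OnEdge-apart {_} {d} {d′} l l′ _ (inj₂ refl) (inj₁ e) = left≢right d′ d l′ l (cong vtx (sym e))
  OnEdge-apart l l′ (≢₁ , ≢₂) (inj₂ refl) (inj₂ e) = ≢₂ (cong vtx e)

  -- Removed edges are vertex-disjoint, so at a touched vertex exactly one of the two edges is
  -- replaced.
  On-flip : ∀ {es s} → All Left es → AllPairs Apart es → On es s → ¬ On es (flip s)
  On-flip (l ∷ _)  (_ ∷ _)   (here p)  (here q)  = OnEdge-flip l p q
  On-flip (l ∷ ls) (ap ∷ _)  (here p)  (there q) =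
    let (l′ , a) , q′ = All.lookupAny (All.zip (ls , ap)) q in OnEdge-apart l l′ a p q′
  On-flip (l ∷ ls) (ap ∷ _)  (there p) (here q)  =
    let (l′ , (≢₁ , ≢₂)) , p′ = All.lookupAny (All.zip (ls , ap)) p
    in OnEdge-apart l′ l ((λ e → ≢₁ (sym e)) , (λ e → ≢₂ (sym e))) p′ q
  On-flip (_ ∷ ls) (_ ∷ aps) (there p) (there q) = On-flip ls aps p q

  -- Properness is inherited at untouched vertices and is `Good` at touched ones; the cycles stay
  -- long by surgery with the removed edges as `T`.
  exchange : All Left ds → AllPairs Apart ds → AllPairs (Far h) ds →
             (∀ s → ¬ On ds s → rev′ s ≡ rev s) →
             (∀ s → On ds s → ∃ (Good s)) →
             (∀ s → ¬ On ds s → ¬ On ds (flip s) → ecol c H (flip s) ≢ ecol c H s) →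
             Long h → Factor h c
  exchange left apart far agree good proper lng = H′ , proper′ ,
    Surgery.long H H′ (On ds) On? agree (λ s → Any.map OnEdge-rev) closed {h} lng (Far-On {h} far)
    where
    closed : ∀ s → On ds s → On ds (rev′ s)
    closed s on with good s on
    ... | s′ , refl , on′ , _ = on′
    agreeCol : ∀ s → ¬ On ds s → ecol c H′ s ≡ ecol c H s
    agreeCol s ¬on = cong (λ d → col c (vtx s) (vtx d)) (agree s ¬on)
    touched : ∀ s → On ds s → ecol c H′ (flip s) ≢ ecol c H′ s
    touched s on e with good s on
    ... | s′ , refl , _ , ≢col = ≢col (trans (sym e) (agreeCol (flip s) (On-flip left apart on)))
    proper′ : Proper c H′
    proper′ s e with On? s | On? (flip s)
    ... | yes on | _      = touched s on e
    ... | no _   | yes on = touched (flip s) on (trans (cong (ecol c H′) (flip-involutive s)) (sym e))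
    ... | no ¬on | no ¬on′ = proper s ¬on ¬on′ (trans (sym (agreeCol (flip s) ¬on′)) (trans e (agreeCol s ¬on)))

-- Repairing a factor after the colour of one edge has changed.

MultiplicityBound : ∀ {n} → ℕ → Coloring n → Set
MultiplicityBound k c = ∀ z γ → count (λ j → col c z (opp z j) ≟ γ) ≤ k

-- A vertex with exactly one selected dart b loses only the colour κ b;
-- one with both darts selected loses none.
pick : ∀ (p : Bool → Bool) (κ : Bool → ℕ) γ → κ true ≢ κ false → p true ∨ p false ≡ true →
  (p true xor p false ≡ true × γ ≡ (if p true then κ true else κ false)) ⊎ (∃ λ b → p b ≡ true × γ ≢ κ b)
pick p κ γ κ≢ sup with p true in pt | p false in pf
... | true | true with γ ≟ κ true
...   | no γ≢   = inj₂ (true , pt , γ≢)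
...   | yes γ≡  = inj₂ (false , pf , λ e → κ≢ (trans (sym γ≡) e))
pick p κ γ κ≢ sup | true | false with γ ≟ κ true
...   | no γ≢   = inj₂ (true , pt , γ≢)
...   | yes γ≡  = inj₁ (refl , γ≡)
pick p κ γ κ≢ sup | false | true with γ ≟ κ false
...   | no γ≢   = inj₂ (false , pf , γ≢)
...   | yes γ≡  = inj₁ (refl , γ≡)

does-sound : ∀ {P : Set} (P? : Dec P) → does P? ≡ true → P
does-sound (yes p) _ = p

some-dart : ∀ (p : Bool → Bool) → p true ∨ p false ≡ true → ∃ λ b → p b ≡ true
some-dart p sup with p true in pt
... | true  = true , pt
... | false = false , sup

-- `d₀` is the dart at x of the edge xy being restored. Properness is assumed away from x and y
-- only, the two places where the new colour can do harm.
module Step {n : ℕ} (h : ℕ) (c : Coloring n) (H : TwoRegular n) (d₀ : Dart n)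
  (left₀ : side (vtx d₀) ≡ true)
  (proper : ∀ s → vtx s ≢ vtx d₀ → vtx s ≢ vtx (TwoRegular.rev H d₀) → ecol c H (flip s) ≢ ecol c H s)
  (long : Walk.Long H h) where

  open Walk H
  open Near h H

  E : Dart n → ℕ
  E = ecol c H

  e₀ : Dart n
  e₀ = rev d₀

  -- The edge of the dart e may be exchanged with that of d so that vtx d and vtx e become adjacent.
  Cand : Dart n → Dart n → Set
  Cand d e = vtx e ≢ vtx (rev d) × vtx e ∉ near (vtx d)
           × col c (vtx d) (vtx e) ≢ E (flip d) × col c (vtx d) (vtx e) ≢ E (flip e)

  Cand? : ∀ d e → Dec (Cand d e)
  Cand? d e = ¬? (vtx e ≟ⱽ vtx (rev d)) ×-dec ¬? (vtx e ∈? near (vtx d))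
            ×-dec ¬? (col c (vtx d) (vtx e) ≟ E (flip d)) ×-dec ¬? (col c (vtx d) (vtx e) ≟ E (flip e))

  E-rev : ∀ s → E (rev s) ≡ E s
  E-rev s = trans (cong (λ d → col c (vtx (rev s)) (vtx d)) (involutive s)) (col-sym c (vtx (rev s)) (vtx s))

  -- A dart at `vtx d` is `d` or `flip d`. The first would make `vtx (rev s)` the partner of `d`,
  -- the second its other neighbour, to which the edge has the forbidden colour `E (flip d)`.
  Cand-vtx : ∀ {d s} → Cand d (rev s) → vtx s ≢ vtx d
  Cand-vtx {d} {s} (≢₁ , _ , ≢₃ , _) e with same-vtx d s (sym e)
  ... | inj₁ refl = ≢₁ refl
  ... | inj₂ refl = ≢₃ refl

  -- The partner and colour conditions of `Cand` supply the two exclusions that `near` does not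
  -- cover.
  Cand-far : ∀ {d s} → side (vtx s) ≡ side (vtx d) → Cand d (rev s) → Far h d s
  Cand-far {d} {s} same (≢₁ , ∉near , ≢₃ , _) =
    far-if d s same ∉near (≢₁ ∘ cong vtx) (≢₃ ∘ cong (col c (vtx d)))

  proper-off : ∀ {ds} → On (d₀ ∷ ds) d₀ → On (d₀ ∷ ds) (rev d₀) →
    ∀ s → ¬ On (d₀ ∷ ds) s → ¬ On (d₀ ∷ ds) (flip s) → E (flip s) ≢ E s
  proper-off {ds} on on′ s ¬on ¬on′ = proper s (off d₀ on) (off (rev d₀) on′)
    where
    off : ∀ d → On (d₀ ∷ ds) d → vtx s ≢ vtx d
    off d on-d e with same-vtx s d e
    ... | inj₁ refl = ¬on on-d
    ... | inj₂ refl = ¬on′ on-d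

  module _ (d₁ : Dart n) (left₁ : side (vtx d₁) ≡ true) (cand₁ : Cand d₀ (rev d₁)) where

    same₀₁ : side (vtx d₀) ≡ side (vtx d₁)
    same₀₁ = trans left₀ (sym left₁)

    module S₁ = Switch H d₀ d₁ same₀₁

    H₁ : TwoRegular n
    H₁ = S₁.switch

    -- With `d₀` at x, `d₁` at v′ and their reverses at y and v, one switch creates xv and v′y. This
    -- serves the case where both choices fall on the same edge.
    exchange₂ : Cand e₀ d₁ → Factor h c
    exchange₂ cand₁′ = X.exchange
      (left₀ ∷ left₁ ∷ [])
      ((((λ e → Cand-vtx cand₁ (sym e)) , (λ e → proj₁ cand₁ (sym e))) ∷ []) ∷ [] ∷ [])
      ((Cand-far (sym same₀₁) cand₁ ∷ []) ∷ [] ∷ [])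
      agree good (proper-off (here (inj₁ refl)) (here (inj₂ refl))) long
      where
      module X = Exchange h c H H₁ (d₀ ∷ d₁ ∷ [])
      module H₁ = TwoRegular H₁
      agree : ∀ s → ¬ On (d₀ ∷ d₁ ∷ []) s → H₁.rev s ≡ rev s
      agree s ¬on = S₁.switch-other
        (λ e → ¬on (here (inj₁ e))) (λ e → ¬on (there (here (inj₁ e))))
        (λ e → ¬on (here (inj₂ (trans (sym (involutive s)) (cong rev e)))))
        (λ e → ¬on (there (here (inj₂ (trans (sym (involutive s)) (cong rev e))))))
      good : ∀ s → On (d₀ ∷ d₁ ∷ []) s → ∃ (X.Good s)
      good s (here (inj₁ refl)) = rev d₁ , S₁.switch-left , there (here (inj₂ refl)) , proj₁ (proj₂ (proj₂ cand₁))
      good s (here (inj₂ refl)) = d₁ , trans (cong H₁.rev (sym S₁.switch-right)) (H₁.involutive d₁)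
        , there (here (inj₁ refl)) , proj₁ (proj₂ (proj₂ cand₁′))
      good s (there (here (inj₁ refl))) = rev d₀ , S₁.switch-right , here (inj₂ refl)
        , (λ e → proj₂ (proj₂ (proj₂ cand₁′)) (trans (col-sym c (vtx (rev d₀)) (vtx d₁)) e))
      good s (there (here (inj₂ refl))) = d₀ , trans (cong H₁.rev (sym S₁.switch-left)) (H₁.involutive d₀)
        , here (inj₁ refl) , (λ e → proj₂ (proj₂ (proj₂ cand₁)) (trans (col-sym c (vtx d₀) (vtx (rev d₁))) e))

    -- With `d₂` at w′ and `rev d₂` at w, a second switch turns v′y and ww′ into v′w and w′y.
    -- Colours and lengths are verified for `H₂` only; the intermediate `H₁` may be improper.
    exchange₃ : ∀ d₂ → side (vtx d₂) ≡ true → d₁ ≢ d₂ → Cand e₀ d₂ →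
      col c (vtx d₁) (vtx (rev d₂)) ≢ E (flip d₁) → col c (vtx d₁) (vtx (rev d₂)) ≢ E (flip (rev d₂)) →
      vtx (rev d₂) ∉ near (vtx d₁) → Factor h c
    exchange₃ d₂ left₂ d₁≢d₂ cand₂ ≢ₗ ≢ᵣ ∉near = X.exchange
      (left₀ ∷ left₁ ∷ left₂ ∷ [])
      ((((λ e → Cand-vtx cand₁ (sym e)) , (λ e → proj₁ cand₁ (sym e)))
        ∷ (x≢w′ , (λ e → Cand-vtx cand₂′ (sym e))) ∷ []) ∷ ((u≢w′ , v≢w) ∷ []) ∷ [] ∷ [])
      ((Cand-far (sym same₀₁) cand₁ ∷ Far-rev {h} (Cand-far same-e cand₂′) ∷ [])
        ∷ (far-if d₁ d₂ (sym same₁₂) ∉near v∉flip (≢ₗ ∘ cong (col c (vtx d₁))) ∷ []) ∷ [] ∷ [])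
      agree good (proper-off (here (inj₁ refl)) (here (inj₂ refl))) long
      where
      ds : List (Dart n)
      ds = d₀ ∷ d₁ ∷ d₂ ∷ []
      same₁₂ : side (vtx d₁) ≡ side (vtx d₂)
      same₁₂ = trans left₁ (sym left₂)
      same-e : side (vtx (rev d₂)) ≡ side (vtx e₀)
      same-e = trans (crossing d₂) (trans (cong not (trans left₂ (sym left₀))) (sym (crossing d₀)))
      cand₂′ : Cand e₀ (rev (rev d₂))
      cand₂′ = subst (Cand e₀) (sym (involutive d₂)) cand₂
      x≢w′ : vtx d₀ ≢ vtx d₂
      x≢w′ e = proj₁ cand₂ (trans (sym e) (cong vtx (sym (involutive d₀))))
      u≢w′ : vtx d₁ ≢ vtx d₂
      u≢w′ e with same-vtx d₁ d₂ e
      ... | inj₁ refl = d₁≢d₂ refl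
      ... | inj₂ refl = ≢ₗ refl
      -- If ww′ were the second edge at v, then w = v and the wanted edge v′w would be vv′ itself,
      -- whose colour `≢ᵣ` forbids.
      v∉flip : rev d₂ ≢ flip (rev d₁)
      v∉flip e = ≢ᵣ (begin
        col c (vtx d₁) (vtx (rev d₂)) ≡⟨ cong (λ s → col c (vtx d₁) (vtx s)) e ⟩
        E d₁                          ≡⟨ E-rev d₁ ⟨
        E (rev d₁)                    ≡⟨ cong E (flip-involutive (rev d₁)) ⟨
        E (flip (flip (rev d₁)))      ≡⟨ cong (E ∘ flip) e ⟨
        E (flip (rev d₂))             ∎)
        where open ≡-Reasoning
      v≢w : vtx (rev d₁) ≢ vtx (rev d₂)
      v≢w e with same-vtx (rev d₁) (rev d₂) e
      ... | inj₁ e′ = d₁≢d₂ (rev-injective (sym e′))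
      ... | inj₂ e′ = v∉flip e′

      module S₂ = Switch H₁ d₁ d₂ same₁₂
      H₂ : TwoRegular n
      H₂ = S₂.switch
      module H₁ = TwoRegular H₁
      module H₂ = TwoRegular H₂
      module X = Exchange h c H H₂ ds

      rev≢left : ∀ {d d′} → side (vtx d) ≡ true → side (vtx d′) ≡ true → rev d ≢ d′
      rev≢left {d} l l′ e = clash e (trans (crossing d) (cong not (trans l (sym l′))))

      agree₁ : ∀ s → ¬ On ds s → H₁.rev s ≡ rev s
      agree₁ s ¬on = S₁.switch-other
        (λ e → ¬on (here (inj₁ e))) (λ e → ¬on (there (here (inj₁ e))))
        (λ e → ¬on (here (inj₂ (trans (sym (involutive s)) (cong rev e)))))
        (λ e → ¬on (there (here (inj₂ (trans (sym (involutive s)) (cong rev e))))))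
      agree : ∀ s → ¬ On ds s → H₂.rev s ≡ rev s
      agree s ¬on = trans (S₂.switch-other
        (λ e → ¬on (there (here (inj₁ e)))) (λ e → ¬on (there (there (here (inj₁ e)))))
        (λ e → ¬on (there (here (inj₂ (trans (sym (involutive s)) (cong rev (trans (sym eq) e)))))))
        (λ e → ¬on (there (there (here (inj₂ (trans (sym (involutive s)) (cong rev (trans (sym eq) e)))))))))
        eq
        where
        eq : H₁.rev s ≡ rev s
        eq = agree₁ s ¬on

      r₀ : H₂.rev d₀ ≡ rev d₁
      r₀ = trans (S₂.switch-other (λ e → Cand-vtx cand₁ (cong vtx (sym e))) (x≢w′ ∘ cong vtx)
        (λ e → rev≢ d₁ (trans (sym S₁.switch-left) e))
        (λ e → rev≢left left₁ left₂ (trans (sym S₁.switch-left) e))) S₁.switch-left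
      r₁ : H₂.rev d₁ ≡ rev d₂
      r₁ = trans S₂.switch-left (S₁.switch-other (λ e → x≢w′ (cong vtx (sym e))) (d₁≢d₂ ∘ sym)
        (rev≢left left₂ left₀) (rev≢left left₂ left₁))
      r₂ : H₂.rev d₂ ≡ rev d₀
      r₂ = trans S₂.switch-right S₁.switch-right
      back : ∀ {s s′} → H₂.rev s ≡ s′ → H₂.rev s′ ≡ s
      back {s} e = trans (cong H₂.rev (sym e)) (H₂.involutive s)

      good : ∀ s → On ds s → ∃ (X.Good s)
      good s (here (inj₁ refl)) = rev d₁ , r₀ , there (here (inj₂ refl)) , proj₁ (proj₂ (proj₂ cand₁))
      good s (here (inj₂ refl)) = d₂ , back r₂ , there (there (here (inj₁ refl))) , proj₁ (proj₂ (proj₂ cand₂))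
      good s (there (here (inj₁ refl))) = rev d₂ , r₁ , there (there (here (inj₂ refl))) , ≢ₗ
      good s (there (here (inj₂ refl))) = d₀ , back r₀ , here (inj₁ refl)
        , (λ e → proj₂ (proj₂ (proj₂ cand₁)) (trans (col-sym c (vtx d₀) (vtx (rev d₁))) e))
      good s (there (there (here (inj₁ refl)))) = rev d₀ , r₂ , here (inj₂ refl)
        , (λ e → proj₂ (proj₂ (proj₂ cand₂)) (trans (col-sym c (vtx (rev d₀)) (vtx d₂)) e))
      good s (there (there (here (inj₂ refl)))) = d₁ , back r₁ , there (here (inj₁ refl))
        , (λ e → ≢ᵣ (trans (col-sym c (vtx d₁) (vtx (rev d₂))) e))

  -- Indexed by the end of the candidate edge that is not joined to `vtx d`: v′ for `P` and w for
  -- `Q`, the two ends of the third new edge.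
  selected : (Fin n → V n) → Dart n → Fin n → Bool → Bool
  selected ι d u b = does (Cand? d (rev (ι u , b)))

  module _ {k : ℕ} (bound : MultiplicityBound k c) where

    -- Of the vertices opposite `vtx d`, at most `k` are lost to the colour `E (flip d)`, one is the
    -- partner and at most `2 * h` are near. At any other, the new edge shares its colour with at
    -- most one of the two edges of `H` there, so some dart is a candidate.
    many-selected : ∀ (ι : Fin n → V n) d → (∀ v → side v ≡ side (vtx d) → ∃ λ u → ι u ≡ v) →
      (∀ s → side (vtx s) ≡ not (side (vtx d)) → vtx s ≢ vtx (rev d) → E (flip s) ≢ E s) →
      n ≤ #total (selected ι d) + (k + (1 + 2 * h))
    many-selected ι d index proper-opp = begin
      n                                                    ≤⟨ count-all all? every ⟩
      count all?                                           ≤⟨ count-∪ free? bad? all? (λ _ p → p) ⟩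
      count free? + count bad?                             ≤⟨ +-mono-≤ free≤ bad≤ ⟩
      #total (selected ι d) + (k + (1 + 2 * h))            ∎
      where
      open ≤-Reasoning
      z : V n
      z = vtx d
      Free Coloured Partner Near Bad : Fin n → Set
      Coloured j = col c z (opp z j) ≡ E (flip d)
      Partner j  = opp z j ≡ vtx (rev d)
      Near j     = opp z j ∈ near z
      Free j     = ¬ Partner j × ¬ Near j × ¬ Coloured j
      Bad j      = Coloured j ⊎ (Partner j ⊎ Near j)
      coloured? : ∀ j → Dec (Coloured j)
      coloured? j = col c z (opp z j) ≟ E (flip d)
      partner? : ∀ j → Dec (Partner j)
      partner? j = opp z j ≟ⱽ vtx (rev d)
      near? : ∀ j → Dec (Near j)
      near? j = opp z j ∈? near z
      free? : ∀ j → Dec (Free j)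
      free? j = ¬? (partner? j) ×-dec ¬? (near? j) ×-dec ¬? (coloured? j)
      bad? : ∀ j → Dec (Bad j)
      bad? j = coloured? j ⊎-dec (partner? j ⊎-dec near? j)
      all? : ∀ j → Dec (Free j ⊎ Bad j)
      all? j = free? j ⊎-dec bad? j
      every : ∀ j → Free j ⊎ Bad j
      every j with coloured? j | partner? j | near? j
      ... | yes p | _     | _     = inj₂ (inj₁ p)
      ... | no _  | yes p | _     = inj₂ (inj₂ (inj₁ p))
      ... | no _  | no _  | yes p = inj₂ (inj₂ (inj₂ p))
      ... | no ¬p | no ¬q | no ¬r = inj₁ (¬q , ¬r , ¬p)
      bad≤ : count bad? ≤ k + (1 + 2 * h)
      bad≤ = ≤-trans (count-∪ coloured? (λ j → partner? j ⊎-dec near? j) bad? (λ _ p → p))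
        (+-mono-≤ (bound z (E (flip d)))
          (≤-trans (count-∪ partner? near? (λ j → partner? j ⊎-dec near? j) (λ _ p → p))
            (+-mono-≤ (count≤1 partner? (λ i j p q → opp-injective z (trans p (sym q))))
                      (≤-trans (count-∈ z (near z)) (≤-reflexive (length-near z))))))

      -- Incidences between free vertices and selected darts, counted in two ways: each free vertex
      -- has at least one, each selected dart at most one.
      Via : Fin n → Bool → Fin n → Set
      Via u b j = Cand d (rev (ι u , b)) × vtx (rev (ι u , b)) ≡ opp z j
      via? : ∀ u b j → Dec (Via u b j)
      via? u b j = Cand? d (rev (ι u , b)) ×-dec (vtx (rev (ι u , b)) ≟ⱽ opp z j)
      χv : Fin n → Bool → Fin n → ℕ
      χv u b j = χ (does (via? u b j))

      cand : ∀ j → Free j → ∃ λ b → Cand d (opp z j , b)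
      cand j (¬p , ¬n , ¬c) with col c z (opp z j) ≟ E (flip (opp z j , true))
      ... | no  c≢ = true  , ¬p , ¬n , ¬c , c≢
      ... | yes e  = false , ¬p , ¬n , ¬c , λ e′ →
        proper-opp (opp z j , true) (side-opp z j) ¬p (trans (sym e) e′)

      via : ∀ j → Free j → ∃ λ u → ∃ λ b → Via u b j
      via j free with cand j free
      ... | b , cnd with index (vtx (rev (opp z j , b)))
                         (trans (crossing (opp z j , b)) (trans (cong not (side-opp z j)) (not-involutive _)))
      ...   | u , ιu≡ = u , proj₂ s , subst (Cand d) (sym back) cnd , cong vtx back
        where
        s : Dart n
        s = rev (opp z j , b)
        back : rev (ι u , proj₂ s) ≡ (opp z j , b)
        back = trans (cong (λ v → rev (v , proj₂ s)) ιu≡) (involutive (opp z j , b))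

      pointwise : ∀ j → χ (does (free? j)) ≤ sum (λ u → χv u true j + χv u false j)
      pointwise j = χ-≤ (free? j) λ free → case via j free of λ where
        (u , true  , v) → ≤-trans (≤-trans (≤-reflexive (sym (χ-yes (via? u true j) v))) (m≤m+n _ _))
                                  (term≤sum (λ u → χv u true j + χv u false j) u)
        (u , false , v) → ≤-trans (≤-trans (≤-reflexive (sym (χ-yes (via? u false j) v))) (m≤n+m _ _))
                                  (term≤sum (λ u → χv u true j + χv u false j) u)

      once : ∀ u b → sum (χv u b) ≤ χ (selected ι d u b)
      once u b = case Cand? d (rev (ι u , b)) of λ where
        (no ¬cnd) → ≤-trans (≤-reflexive (sum-zero (χv u b) (λ j → χ-no (via? u b j) (¬cnd ∘ proj₁)))) z≤n
        (yes cnd) → ≤-trans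
          (count≤1 (via? u b) λ i j p q → opp-injective z (trans (sym (proj₂ p)) (proj₂ q)))
          (≤-reflexive (sym (χ-yes (Cand? d (rev (ι u , b))) cnd)))

      free≤ : count free? ≤ #total (selected ι d)
      free≤ = begin
        count free?                                             ≤⟨ sum-mono pointwise ⟩
        sum (λ j → sum (λ u → χv u true j + χv u false j))      ≡⟨ ∑-comm (λ j u → χv u true j + χv u false j) ⟩
        sum (λ u → sum (λ j → χv u true j + χv u false j))      ≡⟨ sum-cong-≗ (λ u → ∑-distrib-+ (χv u true) (χv u false)) ⟩
        sum (λ u → sum (χv u true) + sum (χv u false))          ≤⟨ sum-mono (λ u → +-mono-≤ (once u true) (once u false)) ⟩
        #total (selected ι d)                                   ∎

    P Q : Fin n → Bool → Bool
    P = selected inj₁ d₀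
    Q = selected inj₂ e₀

    Success : Fin n → Bool → Fin n → Bool → Set
    Success u b w b′ = Cand d₀ (rev (inj₁ u , b)) × Cand e₀ (rev (inj₂ w , b′))
      × c u w ≢ E (flip (inj₁ u , b)) × c u w ≢ E (flip (inj₂ w , b′)) × inj₂ w ∉ near (inj₁ u)

    success? : Dec (∃ λ u → ∃ λ b → ∃ λ w → ∃ λ b′ → Success u b w b′)
    success? = any? λ u → ∃Bool? λ b → any? λ w → ∃Bool? λ b′ →
      Cand? d₀ (rev (inj₁ u , b)) ×-dec Cand? e₀ (rev (inj₂ w , b′))
      ×-dec ¬? (c u w ≟ E (flip (inj₁ u , b))) ×-dec ¬? (c u w ≟ E (flip (inj₂ w , b′)))
      ×-dec ¬? (inj₂ w ∈? near (inj₁ u))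

    right₀ : side (vtx e₀) ≡ false
    right₀ = trans (crossing d₀) (cong not left₀)

    -- At a vertex with exactly one selected dart, the colour of the edge kept when that dart is
    -- exchanged.
    α β : Fin n → ℕ
    α u = if P u true then E (flip (inj₁ u , true)) else E (flip (inj₁ u , false))
    β w = if Q w true then E (flip (inj₂ w , true)) else E (flip (inj₂ w , false))

    nearᵇ : Fin n → Fin n → Bool
    nearᵇ u w = does (inj₂ w ∈? near (inj₁ u))

    -- `pick` looks at each of the two vertices for a selected dart whose kept edge does not clash
    -- with `c u w`. If both searches succeed, only nearness can prevent `Success`.
    blocked : ¬ (∃ λ u → ∃ λ b → ∃ λ w → ∃ λ b′ → Success u b w b′) →
      ∀ u w → P u true ∨ P u false ≡ true → Q w true ∨ Q w false ≡ true →
      (single P u ≡ true × c u w ≡ α u) ⊎ (single Q w ≡ true × c u w ≡ β w) ⊎ nearᵇ u w ≡ true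
    blocked none u w supP supQ
      with pick (P u) (λ b → E (flip (inj₁ u , b))) (c u w) κP supP
         | pick (Q w) (λ b → E (flip (inj₂ w , b))) (c u w) κQ supQ
      where
      -- A supported vertex is not an end of the edge of `d₀`, so `H` is proper there.
      κP : E (inj₁ u , false) ≢ E (inj₁ u , true)
      κP with some-dart (P u) supP
      ... | b , pb = proper (inj₁ u , true)
        (Cand-vtx {s = inj₁ u , b} (does-sound (Cand? d₀ (rev (inj₁ u , b))) pb))
        (λ e → not-¬ refl (trans (cong side e) right₀))
      κQ : E (inj₂ w , false) ≢ E (inj₂ w , true)
      κQ with some-dart (Q w) supQ
      ... | b , qb = proper (inj₂ w , true)
        (λ e → not-¬ refl (trans (cong side e) left₀))
        (Cand-vtx {s = inj₂ w , b} (does-sound (Cand? e₀ (rev (inj₂ w , b))) qb))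
    ... | inj₁ s | _ = inj₁ s
    ... | inj₂ _ | inj₁ s = inj₂ (inj₁ s)
    ... | inj₂ (b , pb , ≢₁) | inj₂ (b′ , qb , ≢₂) = inj₂ (inj₂ (dec-true (inj₂ w ∈? near (inj₁ u))
      (decidable-stable (inj₂ w ∈? near (inj₁ u)) λ ∉near →
        none (u , b , w , b′ , does-sound (Cand? d₀ (rev (inj₁ u , b))) pb
             , does-sound (Cand? e₀ (rev (inj₂ w , b′))) qb , ≢₁ , ≢₂ , ∉near))))

    step : ∀ {δ} → 1 ≤ k → 1 ≤ δ → 2 * h ≤ suc δ → 2 * k + 2 * h + δ + (k + (1 + 2 * h)) ≤ n → Factor h c
    step {δ} 1≤k 1≤δ ε≤ n≥ with success?
    ... | yes (u , b , w , b′ , candP , candQ , ≢₁ , ≢₂ , ∉near) = result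
      where
      d₁ d₂ : Dart n
      d₁ = inj₁ u , b
      d₂ = rev (inj₂ w , b′)
      e₂≡ : rev d₂ ≡ (inj₂ w , b′)
      e₂≡ = involutive (inj₂ w , b′)
      result : Factor h c
      result with d₁ ≟ᴰ d₂
      ... | yes e = exchange₂ d₁ refl candP (subst (Cand e₀) (sym e) candQ)
      ... | no d₁≢d₂ = exchange₃ d₁ refl candP d₂ (crossing (inj₂ w , b′)) d₁≢d₂ candQ
        (subst (λ s → col c (inj₁ u) (vtx s) ≢ E (flip d₁)) (sym e₂≡) ≢₁)
        (subst (λ s → col c (inj₁ u) (vtx s) ≢ E (flip s)) (sym e₂≡) ≢₂)
        (subst (λ s → vtx s ∉ near (inj₁ u)) (sym e₂≡) ∉near)
    ... | no none = ⊥-elim (contradictory (≤-total (#support P) (#support Q)))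
      where
      m≤P : 2 * k + 2 * h + δ ≤ #total P
      m≤P = +-cancelʳ-≤ (k + (1 + 2 * h)) _ _ (≤-trans n≥ (many-selected inj₁ d₀
        (λ v e → left-index v (trans e left₀))
        (λ s sd → proper s (λ e → not-¬ refl (trans (cong side (sym e)) sd)))))
      m≤Q : 2 * k + 2 * h + δ ≤ #total Q
      m≤Q = +-cancelʳ-≤ (k + (1 + 2 * h)) _ _ (≤-trans n≥ (many-selected inj₂ e₀
        (λ v e → right-index v (trans e right₀))
        (λ s sd ≢x → proper s (λ e → ≢x (trans e (cong vtx (sym (involutive d₀)))))
          (λ e → not-¬ refl (trans (cong side (sym e)) sd)))))
      near-rows : ∀ u → sum (λ w → χ (nearᵇ u w)) ≤ 2 * h
      near-rows u = ≤-trans (count-∈ (inj₁ u) (near (inj₁ u))) (≤-reflexive (length-near (inj₁ u)))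
      near-cols : ∀ w → sum (λ u → χ (nearᵇ u w)) ≤ 2 * h
      near-cols w = ≤-trans (count-mono (λ u → inj₂ w ∈? near (inj₁ u)) (λ u → inj₁ u ∈? near (inj₂ w)) (λ _ → near-sym))
        (≤-trans (count-∈ (inj₂ w) (near (inj₂ w))) (≤-reflexive (length-near (inj₂ w))))
      productP : #support P * #support Q ≤ k * #single P + k * #single Q + 2 * h * #support P
      productP = support-product c P Q α β nearᵇ (λ u → bound (inj₁ u)) (λ w → bound (inj₂ w)) near-rows (blocked none)
      -- The same count with the sides exchanged: `support-contradiction` wants the smaller support
      -- first, and near pairs are charged to it.
      productQ : #support Q * #support P ≤ k * #single Q + k * #single P + 2 * h * #support Q
      productQ = support-product (λ w u → c u w) Q P β α (λ w u → nearᵇ u w)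
        (λ w → bound (inj₂ w)) (λ u → bound (inj₁ u)) near-cols swapped
        where
        swapped : ∀ w u → Q w true ∨ Q w false ≡ true → P u true ∨ P u false ≡ true →
          (single Q w ≡ true × c u w ≡ β w) ⊎ (single P u ≡ true × c u w ≡ α u) ⊎ nearᵇ u w ≡ true
        swapped w u supQ supP with blocked none u w supP supQ
        ... | inj₁ x        = inj₂ (inj₁ x)
        ... | inj₂ (inj₁ x) = inj₁ x
        ... | inj₂ (inj₂ x) = inj₂ (inj₂ x)
      contradictory : #support P ≤ #support Q ⊎ #support Q ≤ #support P → ⊥
      contradictory (inj₁ P≤Q) = support-contradiction (#single P) (#double P) (#single Q) (#double Q) 1≤k 1≤δ ε≤
        (subst (2 * k + 2 * h + δ ≤_) (total-split P) m≤P) (subst (2 * k + 2 * h + δ ≤_) (total-split Q) m≤Q)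
        (subst₂ _≤_ (support-split P) (support-split Q) P≤Q)
        (subst₂ (λ A B → A * B ≤ k * #single P + k * #single Q + 2 * h * A) (support-split P) (support-split Q) productP)
      contradictory (inj₂ Q≤P) = support-contradiction (#single Q) (#double Q) (#single P) (#double P) 1≤k 1≤δ ε≤
        (subst (2 * k + 2 * h + δ ≤_) (total-split Q) m≤Q) (subst (2 * k + 2 * h + δ ≤_) (total-split P) m≤P)
        (subst₂ _≤_ (support-split Q) (support-split P) Q≤P)
        (subst₂ (λ A B → A * B ≤ k * #single Q + k * #single P + 2 * h * A) (support-split Q) (support-split P) productQ)

-- The Hamilton cycle that serves the rainbow colouring.

module HamiltonCycle (n′ : ℕ) where
  n : ℕ
  n = suc n′

  -- Addition of `a` modulo `n`; `shift n′` acts as subtraction of 1.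
  shift : ℕ → Fin n → Fin n
  shift a i = fromℕ< (m%n<n (toℕ i + a) n)

  toℕ-shift : ∀ a i → toℕ (shift a i) ≡ (toℕ i + a) % n
  toℕ-shift a i = toℕ-fromℕ< (m%n<n (toℕ i + a) n)

  %-absorb : ∀ m a → (m % n + a) % n ≡ (m + a) % n
  %-absorb m a = begin
    (m % n + a) % n           ≡⟨ %-distribˡ-+ (m % n) a n ⟩
    (m % n % n + a % n) % n   ≡⟨ cong (λ x → (x + a % n) % n) (m%n%n≡m%n m n) ⟩
    (m % n + a % n) % n       ≡⟨ %-distribˡ-+ m a n ⟨
    (m + a) % n               ∎
    where open ≡-Reasoning

  shift-+ : ∀ a b i → shift a (shift b i) ≡ shift (b + a) i
  shift-+ a b i = toℕ-injective (begin
    toℕ (shift a (shift b i))   ≡⟨ toℕ-shift a (shift b i) ⟩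
    (toℕ (shift b i) + a) % n   ≡⟨ cong (λ x → (x + a) % n) (toℕ-shift b i) ⟩
    ((toℕ i + b) % n + a) % n   ≡⟨ %-absorb (toℕ i + b) a ⟩
    (toℕ i + b + a) % n         ≡⟨ cong (_% n) (+-assoc (toℕ i) b a) ⟩
    (toℕ i + (b + a)) % n       ≡⟨ toℕ-shift (b + a) i ⟨
    toℕ (shift (b + a) i)       ∎)
    where open ≡-Reasoning

  shift-n : ∀ i → shift n i ≡ i
  shift-n i = toℕ-injective (trans (toℕ-shift n i) (trans ([m+n]%n≡m%n (toℕ i) n) (m<n⇒m%n≡m (toℕ<n i))))

  shift-0 : ∀ i → shift 0 i ≡ i
  shift-0 i = toℕ-injective (trans (toℕ-shift 0 i) (trans (cong (_% n) (+-identityʳ (toℕ i))) (m<n⇒m%n≡m (toℕ<n i))))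

  -- `toℕ i + a` has remainder `toℕ i`, so `n` divides the positive number `a`.
  shift-fixed : ∀ a i → 1 ≤ a → shift a i ≡ i → n ≤ a
  shift-fixed (suc a) i _ e = ∣⇒≤ (divides ((toℕ i + suc a) / n) (+-cancelˡ-≡ (toℕ i) _ _ (begin
    toℕ i + suc a                                              ≡⟨ m≡m%n+[m/n]*n (toℕ i + suc a) n ⟩
    (toℕ i + suc a) % n + (toℕ i + suc a) / n * n
      ≡⟨ cong (_+ (toℕ i + suc a) / n * n) (trans (sym (toℕ-shift (suc a) i)) (cong toℕ e)) ⟩
    toℕ i + (toℕ i + suc a) / n * n            ∎)))
    where open ≡-Reasoning

  shift-cancel : ∀ a b i → b + a ≡ n → shift a (shift b i) ≡ i
  shift-cancel a b i e = trans (shift-+ a b i) (trans (cong (λ m → shift m i) e) (shift-n i))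

  -- The `true` darts match left i with right i, the `false` darts left i with right i + 1.
  cycle : TwoRegular n
  cycle = record { rev = r ; involutive = inv ; crossing = cross }
    where
    r : Dart n → Dart n
    r (inj₁ i , true)  = inj₂ i , true
    r (inj₂ i , true)  = inj₁ i , true
    r (inj₁ i , false) = inj₂ (shift 1 i) , false
    r (inj₂ i , false) = inj₁ (shift n′ i) , false
    inv : ∀ s → r (r s) ≡ s
    inv (inj₁ i , true)  = refl
    inv (inj₂ i , true)  = refl
    inv (inj₁ i , false) = cong (λ j → inj₁ j , false) (shift-cancel n′ 1 i refl)
    inv (inj₂ i , false) = cong (λ j → inj₂ j , false) (shift-cancel 1 n′ i (+-comm n′ 1))
    cross : ∀ s → side (vtx (r s)) ≡ not (side (vtx s))
    cross (inj₁ i , true)  = refl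
    cross (inj₂ i , true)  = refl
    cross (inj₁ i , false) = refl
    cross (inj₂ i , false) = refl

  open Walk cycle

  walk-shift : ∀ l i → walk (l * 2) (inj₁ i , false) ≡ (inj₁ (shift l i) , false)
  walk-shift zero    i = cong (λ j → inj₁ j , false) (sym (shift-0 i))
  walk-shift (suc l) i = trans (walk-shift l (shift 1 i)) (cong (λ j → inj₁ j , false) (shift-+ l 1 i))

  cycle-long : ∀ h → h < n → Long h
  cycle-long h h<n i s 1≤i i≤ closed with parity i
  ... | l , inj₂ refl = clash closed (side-walk-odd l s)
  ... | zero , inj₁ refl = <⇒≱ 1≤i z≤n
  ... | suc l , inj₁ refl = go s closed
    where
    forward : ∀ i → walk (suc l * 2) (inj₁ i , false) ≢ (inj₁ i , false)
    forward i e = <⇒≱ h<n (≤-trans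
      (shift-fixed (suc l) i (s≤s z≤n) (inj₁-injective (cong vtx (trans (sym (walk-shift (suc l) i)) e))))
      (*-cancelʳ-≤ (suc l) h 2 i≤))
    -- The other darts reduce to `forward`, by one further step or by reversal with `walk-rev′`.
    forward′ : ∀ i → walk (suc l * 2) (inj₂ i , true) ≢ (inj₂ i , true)
    forward′ i e = forward i (trans (walk-suc (suc l * 2) (inj₂ i , true)) (cong σ e))
    go : ∀ s → walk (suc l * 2) s ≢ s
    go (inj₁ i , false) e = forward i e
    go (inj₂ i , true)  e = forward′ i e
    go (inj₁ i , true)  e = forward′ i (walk-rev′ (suc l * 2) {inj₁ i , true} e)
    go (inj₂ i , false) e = forward (shift n′ i) (walk-rev′ (suc l * 2) {inj₂ i , false} e)

  -- An injective colouring separates the two edges at a vertex once their far ends differ; `2 ≤ n`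
  -- makes `shift 1` move every index.
  cycle-proper : ∀ (c : Coloring n) → 2 ≤ n → (∀ i j i′ j′ → c i j ≡ c i′ j′ → i ≡ i′ × j ≡ j′) → Proper c cycle
  cycle-proper c 2≤n inj = proper
    where
    moved : ∀ i → shift 1 i ≢ i
    moved i e = <⇒≱ 2≤n (shift-fixed 1 i ≤-refl e)
    moved′ : ∀ i → shift n′ i ≢ i
    moved′ i e = moved i (trans (cong (shift 1) (sym e)) (shift-cancel 1 n′ i (+-comm n′ 1)))
    proper : Proper c cycle
    proper (inj₁ i , true)  e = moved i (proj₂ (inj _ _ _ _ e))
    proper (inj₁ i , false) e = moved i (sym (proj₂ (inj _ _ _ _ e)))
    proper (inj₂ i , true)  e = moved′ i (proj₁ (inj _ _ _ _ e))
    proper (inj₂ i , false) e = moved′ i (sym (proj₁ (inj _ _ _ _ e)))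

-- Restoring the colours of `c` one edge at a time.

even≢odd′ : ∀ a b → a * 2 ≢ suc (b * 2)
even≢odd′ a b e = even≢odd a b (trans (*-comm 2 a) (trans e (cong suc (*-comm b 2))))

index : ∀ {n} → Coloring n
index i j = toℕ (combine i j)

index-injective : ∀ {n} (i j i′ j′ : Fin n) → index i j ≡ index i′ j′ → i ≡ i′ × j ≡ j′
index-injective i j i′ j′ e = combine-injective i j i′ j′ (toℕ-injective e)

-- The edges of index at least m receive pairwise distinct odd colours, the others
-- keep their colour (doubled): paint 0 is rainbow and paint (n * n) is equivalent to c.
paint : ∀ {n} → Coloring n → ℕ → Coloring n
paint c m i j = if does (index i j <? m) then c i j * 2 else suc (index i j * 2)

module Paint {n : ℕ} (c : Coloring n) where

  paint-low : ∀ m i j → index i j < m → paint c m i j ≡ c i j * 2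
  paint-low m i j lt rewrite dec-true (index i j <? m) lt = refl

  paint-high : ∀ m i j → ¬ index i j < m → paint c m i j ≡ suc (index i j * 2)
  paint-high m i j ≮ rewrite dec-false (index i j <? m) ≮ = refl

  paint-suc : ∀ m i j → index i j ≢ m → paint c (suc m) i j ≡ paint c m i j
  paint-suc m i j ≢m with index i j <? m
  ... | yes lt = trans (paint-low (suc m) i j (m<n⇒m<1+n lt)) (sym (paint-low m i j lt))
  ... | no  ≮  = trans (paint-high (suc m) i j λ lt → case m<1+n⇒m<n∨m≡n lt of λ where
                          (inj₁ lt′) → ≮ lt′
                          (inj₂ e)   → ≢m e)
                       (sym (paint-high m i j ≮))

  paint-even : ∀ m i j l → paint c m i j ≡ l * 2 → c i j ≡ l
  paint-even m i j l e with index i j <? m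
  ... | yes lt = *-cancelʳ-≡ _ _ 2 (trans (sym (paint-low m i j lt)) e)
  ... | no  ≮  = ⊥-elim (even≢odd′ l (index i j) (trans (sym e) (paint-high m i j ≮)))

  paint-odd : ∀ m i j l → paint c m i j ≡ suc (l * 2) → index i j ≡ l
  paint-odd m i j l e with index i j <? m
  ... | yes lt = ⊥-elim (even≢odd′ (c i j) l (trans (sym (paint-low m i j lt)) e))
  ... | no  ≮  = *-cancelʳ-≡ _ _ 2 (suc-injective (trans (sym (paint-high m i j ≮)) e))

  -- An even colour occurs no more often than its half does in `c`; an odd colour belongs to at most
  -- one edge, whence `1 ≤ k`.
  paint-bound : ∀ {k} → 1 ≤ k → MultiplicityBound k c → ∀ m → MultiplicityBound k (paint c m)
  paint-bound 1≤k bound m z γ with parity γ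
  paint-bound 1≤k bound m z@(inj₁ i) γ | l , inj₁ refl =
    ≤-trans (count-mono (λ j → paint c m i j ≟ l * 2) (λ j → c i j ≟ l) (λ j → paint-even m i j l)) (bound z l)
  paint-bound 1≤k bound m z@(inj₂ j) γ | l , inj₁ refl =
    ≤-trans (count-mono (λ i → paint c m i j ≟ l * 2) (λ i → c i j ≟ l) (λ i → paint-even m i j l)) (bound z l)
  paint-bound 1≤k bound m (inj₁ i) γ | l , inj₂ refl =
    ≤-trans (count≤1 (λ j → paint c m i j ≟ suc (l * 2)) λ j j′ e e′ →
      proj₂ (index-injective i j i j′ (trans (paint-odd m i j l e) (sym (paint-odd m i j′ l e′))))) 1≤k
  paint-bound 1≤k bound m (inj₂ j) γ | l , inj₂ refl =
    ≤-trans (count≤1 (λ i → paint c m i j ≟ suc (l * 2)) λ i i′ e e′ →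
      proj₁ (index-injective i j i′ j (trans (paint-odd m i j l e) (sym (paint-odd m i′ j l e′))))) 1≤k

  col-paint-suc : ∀ m u v → col index u v ≢ m → col (paint c (suc m)) u v ≡ col (paint c m) u v
  col-paint-suc m (inj₁ i) (inj₂ j) ≢m = paint-suc m i j ≢m
  col-paint-suc m (inj₂ j) (inj₁ i) ≢m = paint-suc m i j ≢m
  col-paint-suc m (inj₁ _) (inj₁ _) _  = refl
  col-paint-suc m (inj₂ _) (inj₂ _) _  = refl

  col-paint-all : ∀ u v → col (paint c (n * n)) u v ≡ col c u v * 2
  col-paint-all (inj₁ i) (inj₂ j) = paint-low (n * n) i j (toℕ<n (combine i j))
  col-paint-all (inj₂ j) (inj₁ i) = paint-low (n * n) i j (toℕ<n (combine i j))
  col-paint-all (inj₁ _) (inj₁ _) = refl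
  col-paint-all (inj₂ _) (inj₂ _) = refl

  col-index-injective : ∀ (u v u′ v′ : V n) → side v ≡ not (side u) → side v′ ≡ not (side u′) →
    col index u v ≡ col index u′ v′ → u ≡ u′ ⊎ u ≡ v′
  col-index-injective (inj₁ i) (inj₂ j) (inj₁ i′) (inj₂ j′) _ _ e = inj₁ (cong inj₁ (proj₁ (index-injective i j i′ j′ e)))
  col-index-injective (inj₁ i) (inj₂ j) (inj₂ j′) (inj₁ i′) _ _ e = inj₂ (cong inj₁ (proj₁ (index-injective i j i′ j′ e)))
  col-index-injective (inj₂ j) (inj₁ i) (inj₁ i′) (inj₂ j′) _ _ e = inj₂ (cong inj₂ (proj₂ (index-injective i j i′ j′ e)))
  col-index-injective (inj₂ j) (inj₁ i) (inj₂ j′) (inj₁ i′) _ _ e = inj₁ (cong inj₂ (proj₂ (index-injective i j i′ j′ e)))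

  unpaint : ∀ {h} → Factor h (paint c (n * n)) → Factor h c
  unpaint (H , proper , long) = H , (λ s e → proper s (begin
    col (paint c (n * n)) (vtx s) (vtx (rev (flip s))) ≡⟨ col-paint-all (vtx s) (vtx (rev (flip s))) ⟩
    col c (vtx s) (vtx (rev (flip s))) * 2             ≡⟨ cong (_* 2) e ⟩
    col c (vtx s) (vtx (rev s)) * 2                    ≡⟨ col-paint-all (vtx s) (vtx (rev s)) ⟨
    col (paint c (n * n)) (vtx s) (vtx (rev s))        ∎)) , long
    where
    open Walk H
    open ≡-Reasoning

  module _ {h k δ : ℕ} (bound : MultiplicityBound k c) (1≤k : 1 ≤ k) (1≤δ : 1 ≤ δ) (ε≤ : 2 * h ≤ suc δ)
           (n≥ : 2 * k + 2 * h + δ + (k + (1 + 2 * h)) ≤ n) where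

    -- Only the edge of index `m` changes colour. If `H` uses it, the edges of `H` at all vertices
    -- but its two ends keep their colours, as `Step` requires; otherwise `H` itself survives.
    paint-step : ∀ m → Factor h (paint c m) → Factor h (paint c (suc m))
    paint-step m (H , proper , long) with any? (λ u → ∃Bool? (λ b → ecol index H (inj₁ u , b) ≟ m))
    ... | yes (u , b , e) = Step.step h (paint c (suc m)) H d₀ refl proper′ long
                              (paint-bound 1≤k bound (suc m)) 1≤k 1≤δ ε≤ n≥
      where
      open Walk H
      d₀ : Dart n
      d₀ = inj₁ u , b
      unchanged : ∀ s → vtx s ≢ vtx d₀ → vtx s ≢ vtx (rev d₀) → ecol (paint c (suc m)) H s ≡ ecol (paint c m) H s
      unchanged s ≢₁ ≢₂ = col-paint-suc m (vtx s) (vtx (rev s)) λ e′ →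
        case col-index-injective (vtx s) (vtx (rev s)) (vtx d₀) (vtx (rev d₀)) (crossing s) (crossing d₀) (trans e′ (sym e)) of λ where
          (inj₁ eq) → ≢₁ eq
          (inj₂ eq) → ≢₂ eq
      proper′ : ∀ s → vtx s ≢ vtx d₀ → vtx s ≢ vtx (rev d₀) →
                ecol (paint c (suc m)) H (flip s) ≢ ecol (paint c (suc m)) H s
      proper′ s ≢₁ ≢₂ eq = proper s (trans (sym (unchanged (flip s) ≢₁ ≢₂)) (trans eq (unchanged s ≢₁ ≢₂)))
    ... | no none = H , (λ s eq → proper s (trans (sym (unchanged (flip s))) (trans eq (unchanged s)))) , long
      where
      open Walk H
      absent : ∀ s → ecol index H s ≢ m
      absent (inj₁ u , b) e = none (u , b , e)
      absent s@(inj₂ w , b) e with left-index (vtx (rev s)) (crossing s)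
      ... | u , eq = none (u , proj₂ (rev s) , (begin
        col index (inj₁ u) (vtx (rev (inj₁ u , proj₂ (rev s))))
          ≡⟨ cong (λ v → col index v (vtx (rev (v , proj₂ (rev s))))) eq ⟩
        col index (vtx (rev s)) (vtx (rev (rev s))) ≡⟨ cong (λ d → col index (vtx (rev s)) (vtx d)) (involutive s) ⟩
        col index (vtx (rev s)) (vtx s)             ≡⟨ col-sym index (vtx (rev s)) (vtx s) ⟩
        col index (vtx s) (vtx (rev s))             ≡⟨ e ⟩
        m                                           ∎))
        where open ≡-Reasoning
      unchanged : ∀ s → ecol (paint c (suc m)) H s ≡ ecol (paint c m) H s
      unchanged s = col-paint-suc m (vtx s) (vtx (rev s)) (absent s)

    paint-factor : Factor h (paint c 0) → ∀ m → Factor h (paint c m)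
    paint-factor base zero    = base
    paint-factor base (suc m) = paint-step m (paint-factor base m)

factor-exists : ∀ {n h k δ} (c : Coloring n) → MultiplicityBound k c → 1 ≤ k → 1 ≤ δ → 2 * h ≤ suc δ →
  2 * k + 2 * h + δ + (k + (1 + 2 * h)) ≤ n → Factor h c
factor-exists {zero} {h} {k} {δ} c bound (s≤s _) 1≤δ ε≤ n≥ = ⊥-elim (<⇒≱ (s≤s z≤n) n≥)
factor-exists {suc n′} {h} {k} {δ} c bound 1≤k 1≤δ ε≤ n≥ =
  unpaint {h} (paint-factor {h} bound 1≤k 1≤δ ε≤ n≥ base (n * n))
  where
  open HamiltonCycle n′
  open Paint c
  base : Factor h (paint c 0)
  base = cycle , cycle-proper (paint c 0) 2≤n rainbow , cycle-long h h<n
    where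
    rainbow : ∀ i j i′ j′ → paint c 0 i j ≡ paint c 0 i′ j′ → i ≡ i′ × j ≡ j′
    rainbow i j i′ j′ e = index-injective i j i′ j′ (paint-odd 0 i j (index i′ j′) (trans e (paint-high 0 i′ j′ λ ())))
    tail≤n : k + (1 + 2 * h) ≤ n
    tail≤n = ≤-trans (m≤n+m _ (2 * k + 2 * h + δ)) n≥
    2≤n : 2 ≤ n
    2≤n = ≤-trans (+-mono-≤ 1≤k (m≤m+n 1 (2 * h))) tail≤n
    h<n : h < n
    h<n = ≤-trans (s≤s (m≤m+n h _)) (≤-trans (m≤n+m (1 + 2 * h) k) tail≤n)

-- Colour degree against the multiplicity of a colour.

length-filter-filter : ∀ {P Q : ℕ → Set} (P? : ∀ x → Dec (P x)) (Q? : ∀ x → Dec (Q x)) xs →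
  length (filter P? (filter Q? xs)) ≤ length (filter P? xs)
length-filter-filter P? Q? xs = length-mono-≤ (filter⁺ P? P? (λ { refl p → p }) (filter-⊆ Q? xs))

-- Each value other than `γ` takes up a position of its own, apart from the positions of `γ`.
dedup-others : ∀ {n} (f : Fin n → ℕ) γ →
  length (filter (¬? ∘ (γ ≟_)) (deduplicate _≟_ (tabulate f))) + count (λ j → f j ≟ γ) ≤ n
dedup-others {zero}  f γ = z≤n
dedup-others {suc n} f γ = cases (γ ≟ f Fin.zero)
  where
  open ≤-Reasoning
  P? : ∀ x → Dec (¬ γ ≡ x)
  P? = ¬? ∘ (γ ≟_)
  x : ℕ
  x = f Fin.zero
  ds : List ℕ
  ds = deduplicate _≟_ (tabulate (f ∘ Fin.suc))
  rest : List ℕ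
  rest = filter (¬? ∘ (x ≟_)) ds
  k : ℕ
  k = count (λ j → f (Fin.suc j) ≟ γ)
  ih : length (filter P? rest) + k ≤ n
  ih = ≤-trans (+-monoˡ-≤ k (length-filter-filter P? (¬? ∘ (x ≟_)) ds)) (dedup-others (f ∘ Fin.suc) γ)
  cases : Dec (γ ≡ x) → length (filter P? (x ∷ rest)) + (χ (does (x ≟ γ)) + k) ≤ suc n
  cases (yes e) = begin
    length (filter P? (x ∷ rest)) + (χ (does (x ≟ γ)) + k)
      ≡⟨ cong₂ (λ l m → length l + (m + k)) (filter-reject P? (λ ≢ → ≢ e)) (χ-yes (x ≟ γ) (sym e)) ⟩
    length (filter P? rest) + suc k ≡⟨ +-suc _ k ⟩
    suc (length (filter P? rest) + k) ≤⟨ s≤s ih ⟩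
    suc n ∎
  cases (no γ≢) = begin
    length (filter P? (x ∷ rest)) + (χ (does (x ≟ γ)) + k)
      ≡⟨ cong₂ (λ l m → length l + (m + k)) (filter-accept P? γ≢) (χ-no (x ≟ γ) (γ≢ ∘ sym)) ⟩
    suc (length (filter P? rest) + k) ≤⟨ s≤s ih ⟩
    suc n ∎

-- Compared with `dedup-others`, `γ` itself may add one distinct value; hence `suc n`.
dedup-count : ∀ {n} (f : Fin n → ℕ) γ →
  length (deduplicate _≟_ (tabulate f)) + count (λ j → f j ≟ γ) ≤ suc n
dedup-count {zero}  f γ = z≤n
dedup-count {suc n} f γ = cases (x ≟ γ)
  where
  open ≤-Reasoning
  x : ℕ
  x = f Fin.zero
  ds : List ℕ
  ds = deduplicate _≟_ (tabulate (f ∘ Fin.suc))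
  rest : List ℕ
  rest = filter (¬? ∘ (x ≟_)) ds
  k : ℕ
  k = count (λ j → f (Fin.suc j) ≟ γ)
  cases : Dec (x ≡ γ) → suc (length rest) + (χ (does (x ≟ γ)) + k) ≤ suc (suc n)
  cases (yes e) = begin
    suc (length rest) + (χ (does (x ≟ γ)) + k) ≡⟨ cong (λ m → suc (length rest) + (m + k)) (χ-yes (x ≟ γ) e) ⟩
    suc (length rest) + suc k                  ≡⟨ +-suc (suc (length rest)) k ⟩
    suc (suc (length rest + k))                ≤⟨ s≤s (s≤s (subst (λ y → length (filter (¬? ∘ (y ≟_)) ds) + k ≤ n) (sym e)
                                                                  (dedup-others (f ∘ Fin.suc) γ))) ⟩
    suc (suc n)                                ∎
  cases (no x≢) = begin
    suc (length rest) + (χ (does (x ≟ γ)) + k) ≡⟨ cong (λ m → suc (length rest) + (m + k)) (χ-no (x ≟ γ) x≢) ⟩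
    suc (length rest + k)                      ≤⟨ s≤s (+-monoˡ-≤ k (length-filter (¬? ∘ (x ≟_)) ds)) ⟩
    suc (length ds + k)                        ≤⟨ s≤s (dedup-count (f ∘ Fin.suc) γ) ⟩
    suc (suc n)                                ∎

multiplicity : ∀ {n} (c : Coloring n) z γ → colorDegree c z + count (λ j → col c z (opp z j) ≟ γ) ≤ suc n
multiplicity c (inj₁ i) γ = subst (λ xs → length (deduplicate _≟_ xs) + count (λ j → c i j ≟ γ) ≤ _)
  (sym (map-tabulate id (λ j → c i j))) (dedup-count (λ j → c i j) γ)
multiplicity c (inj₂ j) γ = subst (λ xs → length (deduplicate _≟_ xs) + count (λ i → c i j ≟ γ) ≤ _)
  (sym (map-tabulate id (λ i → c i j))) (dedup-count (λ i → c i j) γ)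

-- Reading off the vertex sequences of the cycles.

least : ∀ {P : ℕ → Set} → (∀ l → Dec (P l)) → ∀ N → P N → ∃ λ m → P m × (∀ l → l < m → ¬ P l)
least P? zero    p = 0 , p , λ _ ()
least {P} P? (suc N) p with P? 0
... | yes p₀ = 0 , p₀ , λ _ ()
... | no ¬p₀ with least (P? ∘ suc) N p
...   | m , pm , below = suc m , pm , λ where
        zero    _         → ¬p₀
        (suc l) (s≤s l<m) → below l l<m

-- Numbers the `4 * n` darts for the pigeonhole principle.
encode : ∀ {n} → Dart n → Fin ((n + n) * 2)
encode {n} (v , b) = combine (join n n v) (if b then Fin.zero else Fin.suc Fin.zero)

encode-injective : ∀ {n} (s s′ : Dart n) → encode s ≡ encode s′ → s ≡ s′
encode-injective {n} (v , b) (v′ , b′) e with combine-injective (join n n v) _ (join n n v′) _ e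
... | ev , eb = cong₂ _,_ (trans (sym (splitAt-join n n v)) (trans (cong (splitAt n) ev) (splitAt-join n n v′))) (bit b b′ eb)
  where
  bit : ∀ b b′ → (if b then Fin.zero {1} else Fin.suc Fin.zero) ≡ (if b′ then Fin.zero else Fin.suc Fin.zero) → b ≡ b′
  bit true  true  _ = refl
  bit false false _ = refl

zip-map : ∀ {A B C : Set} (f : A → B) (g : A → C) xs → zip (map f xs) (map g xs) ≡ map (λ x → f x , g x) xs
zip-map f g []       = refl
zip-map f g (x ∷ xs) = cong (_ ∷_) (zip-map f g xs)

module Orbits {n : ℕ} (H : TwoRegular n) where
  open Walk H

  σ-injective : ∀ {s s′} → σ s ≡ σ s′ → s ≡ s′
  σ-injective = rev-injective ∘ flip-injective

  walk-injective : ∀ i {s s′} → walk i s ≡ walk i s′ → s ≡ s′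
  walk-injective zero    e = e
  walk-injective (suc i) e = σ-injective (walk-injective i e)

  period : ∀ s → ∃ λ j → walk (suc j) s ≡ s
  -- One more position is taken than there are darts; injectivity of `walk` cancels a coincidence
  -- back to the start.
  period s with pigeonhole ≤-refl (λ i → encode (walk (toℕ i) s))
  ... | i , j , i<j , e with m≤n⇒∃[o]m+o≡n i<j
  ...   | d , eq = d , walk-injective (toℕ i) (begin
    walk (toℕ i) (walk (suc d) s) ≡⟨ walk-+ (suc d) (toℕ i) s ⟨
    walk (suc d + toℕ i) s        ≡⟨ cong (λ m → walk m s) (trans (cong suc (+-comm d (toℕ i))) eq) ⟩
    walk (toℕ j) s                ≡⟨ encode-injective _ _ e ⟨
    walk (toℕ i) s                ∎)
    where open ≡-Reasoning

  iterate-σ : ∀ s m → iterate σ (σ s) m ≡ map σ (iterate σ s m)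
  iterate-σ s zero    = refl
  iterate-σ s (suc m) = cong (σ s ∷_) (iterate-σ (σ s) m)

  iterate-snoc : ∀ s m → iterate σ s (suc m) ≡ iterate σ s m ++ [ walk m s ]
  iterate-snoc s zero    = refl
  iterate-snoc s (suc m) = cong (s ∷_) (iterate-snoc (σ s) m)

  ∈-iterate⁺ : ∀ {m} l s → l < m → walk l s ∈ iterate σ s m
  ∈-iterate⁺ {suc m} zero    s _         = here refl
  ∈-iterate⁺ {suc m} (suc l) s (s≤s l<m) = there (∈-iterate⁺ l (σ s) l<m)

  ∈-iterate⁻ : ∀ {x} m s → x ∈ iterate σ s m → ∃ λ l → l < m × x ≡ walk l s
  ∈-iterate⁻ (suc m) s (here e)  = 0 , s≤s z≤n , e
  ∈-iterate⁻ (suc m) s (there p) = let l , l<m , e = ∈-iterate⁻ m (σ s) p in suc l , s≤s l<m , e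

  rotate-orbit : ∀ {A : Set} (g : Dart n → A) s j → walk (suc j) s ≡ s →
    rotate (map g (iterate σ s (suc j))) ≡ map (g ∘ σ) (iterate σ s (suc j))
  rotate-orbit g s j closed = begin
    map g (iterate σ (σ s) j) ++ [ g s ]           ≡⟨ map-++ g (iterate σ (σ s) j) [ s ] ⟨
    map g (iterate σ (σ s) j ++ [ s ])             ≡⟨ cong (λ d → map g (iterate σ (σ s) j ++ [ d ])) closed ⟨
    map g (iterate σ (σ s) j ++ [ walk j (σ s) ])  ≡⟨ cong (map g) (iterate-snoc (σ s) j) ⟨
    map g (iterate σ (σ s) (suc j))                ≡⟨ cong (map g) (iterate-σ s (suc j)) ⟩
    map g (map σ (iterate σ s (suc j)))            ≡⟨ map-∘ (iterate σ s (suc j)) ⟨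
    map (g ∘ σ) (iterate σ s (suc j))              ∎
    where open ≡-Reasoning

  -- Stated for arbitrary `g` so as to apply twice: to vertices, giving the edges, and to edges,
  -- giving the consecutive pairs.
  cyclic-pairs : ∀ {A : Set} (g : Dart n → A) s j → walk (suc j) s ≡ s →
    cycleEdges (map g (iterate σ s (suc j))) ≡ map (λ d → g d , g (σ d)) (iterate σ s (suc j))
  cyclic-pairs g s j closed = trans (cong (zip (map g (iterate σ s (suc j)))) (rotate-orbit g s j closed))
    (zip-map g (g ∘ σ) (iterate σ s (suc j)))

  -- The dart `s` is one step after `rev (flip s)`, so such a walk would extend to one from a dart
  -- to its reverse.
  walk≢flip : ∀ i s → walk i s ≢ flip s
  walk≢flip i s e = walk≢rev (suc i) (rev (flip s)) (begin
    walk i (σ (rev (flip s))) ≡⟨ cong (walk i) (trans (σ-rev (flip s)) (flip-involutive s)) ⟩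
    walk i s                  ≡⟨ e ⟩
    flip s                    ≡⟨ involutive (flip s) ⟨
    rev (rev (flip s))        ∎)
    where open ≡-Reasoning

  -- A repeated vertex means a repeated dart or a dart and its flip: the first cannot occur within a
  -- period, the second never occurs.
  unique-orbit : ∀ m s → (∀ l → suc l < m → walk (suc l) s ≢ s) → Unique (map vtx (iterate σ s m))
  unique-orbit zero    s aper = []
  unique-orbit (suc m) s aper = All.map⁺ (All.tabulate fresh) ∷ unique-orbit m (σ s) λ l l<m e →
    aper l (m≤n⇒m≤1+n l<m) (σ-injective (trans (sym (walk-suc (suc l) s)) e))
    where
    fresh : ∀ {d} → d ∈ iterate σ (σ s) m → vtx s ≢ vtx d
    fresh d∈ e with ∈-iterate⁻ m (σ s) d∈
    ... | l , l<m , refl with same-vtx s (walk (suc l) s) e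
    ...   | inj₁ e′ = aper l (s≤s l<m) e′
    ...   | inj₂ e′ = walk≢flip (suc l) s e′

  Closed : List (V n) → Set
  Closed xs = ∀ s → vtx s ∈ xs → vtx (σ s) ∈ xs

  Closed-walk : ∀ {xs} → Closed xs → ∀ i s → vtx s ∈ xs → vtx (walk i s) ∈ xs
  Closed-walk closed zero    s s∈ = s∈
  Closed-walk closed (suc i) s s∈ = Closed-walk closed i (σ s) (closed s s∈)

  -- A dart of the orbit steps forward; its flip steps to the predecessor, which for `s` is the last
  -- dart of the period.
  orbit-closed : ∀ s j → walk (suc j) s ≡ s → Closed (map vtx (iterate σ s (suc j)))
  orbit-closed s j closed d d∈ with ∈-map⁻ vtx d∈
  ... | d′ , d′∈ , e with ∈-iterate⁻ (suc j) s d′∈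
  ...   | l , l< , refl with same-vtx (walk l s) d (sym e)
  ...     | inj₁ refl = forth (m≤n⇒m<n∨m≡n l<)
    where
    forth : suc l < suc j ⊎ suc l ≡ suc j → vtx (σ (walk l s)) ∈ map vtx (iterate σ s (suc j))
    forth (inj₁ lt)   = subst (λ x → vtx x ∈ _) (walk-suc l s) (∈-map⁺ vtx (∈-iterate⁺ (suc l) s lt))
    forth (inj₂ refl) = here (cong vtx (trans (sym (walk-suc l s)) closed))
  ...     | inj₂ refl = back l l<
    where
    from : ∀ d l′ → l′ < suc j → σ (walk l′ s) ≡ d → vtx (σ (flip d)) ∈ map vtx (iterate σ s (suc j))
    from _ l′ l′< refl = subst (λ x → vtx x ∈ _) (sym (σ-flip-σ (walk l′ s))) (∈-map⁺ vtx (∈-iterate⁺ l′ s l′<))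
    back : ∀ l → l < suc j → vtx (σ (flip (walk l s))) ∈ map vtx (iterate σ s (suc j))
    back zero    _  = from s j ≤-refl (trans (sym (walk-suc j s)) closed)
    back (suc l) l< = from (walk (suc l) s) l (<-trans (n<1+n l) l<) (sym (walk-suc l s))

module Extract {n t h : ℕ} (c : Coloring n) (3≤t : 3 ≤ t) (t≤ : t ≤ suc h * 2)
               (H : TwoRegular n) (proper : Proper c H) (long : Walk.Long H h) where
  open Walk H
  open Orbits H

  GoodCycle : List (V n) → Set
  GoodCycle C = IsCycle C × IsPCCycle c C × t ≤ length C

  adjacent : ∀ (u v : V n) → side v ≡ not (side u) → Adj u v
  adjacent (inj₁ _) (inj₂ _) _ = tt
  adjacent (inj₂ _) (inj₁ _) _ = tt

  consecutive : ∀ s → ecol c H s ≢ ecol c H (σ s)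
  consecutive s e = proper (rev s) (trans (sym e) (sym (begin
    col c (vtx (rev s)) (vtx (rev (rev s))) ≡⟨ cong (λ d → col c (vtx (rev s)) (vtx d)) (involutive s) ⟩
    col c (vtx (rev s)) (vtx s)             ≡⟨ col-sym c (vtx (rev s)) (vtx s) ⟩
    col c (vtx s) (vtx (rev s))             ∎)))
    where open ≡-Reasoning

  -- A period is even and exceeds `2 * h`, hence is at least `2 * h + 2`.
  period-long : ∀ s j → walk (suc j) s ≡ s → t ≤ suc j
  period-long s j closed = go (parity (suc j))
    where
    go : (∃ λ l → suc j ≡ l * 2 ⊎ suc j ≡ suc (l * 2)) → t ≤ suc j
    go (l , inj₂ e) = ⊥-elim (clash (trans (sym (cong (λ m → walk m s) e)) closed) (side-walk-odd l s))
    go (l , inj₁ e) = ≤-trans t≤ (≤-trans (*-monoˡ-≤ 2 h<l) (≤-reflexive (sym e)))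
      where
      h<l : h < l
      h<l = ≰⇒> λ l≤h → long (suc j) s (s≤s z≤n) (≤-trans (≤-reflexive e) (*-monoˡ-≤ 2 l≤h)) closed

  orbit-good : ∀ s j → walk (suc j) s ≡ s → GoodCycle (map vtx (iterate σ s (suc j)))
  orbit-good s j closed =
    (≤-trans 3≤t t≤length , subst (All _) (sym edges)
      (All.map⁺ (All.universal (λ d → adjacent (vtx d) (vtx (σ d)) (side-σ d)) O)))
    , subst (All _) (sym pairs) (All.map⁺ (All.universal consecutive O))
    , t≤length
    where
    O : List (Dart n)
    O = iterate σ s (suc j)
    t≤length : t ≤ length (map vtx O)
    t≤length = ≤-trans (period-long s j closed)
      (≤-reflexive (sym (trans (length-map vtx O) (length-iterate σ s (suc j)))))
    edges : cycleEdges (map vtx O) ≡ map (λ d → vtx d , vtx (σ d)) O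
    edges = cyclic-pairs vtx s j closed
    pairs : consecutiveEdges (map vtx O) ≡ map (λ d → (vtx d , vtx (σ d)) , (vtx (σ d) , vtx (σ (σ d)))) O
    pairs = trans (cong cycleEdges edges) (cyclic-pairs (λ d → vtx d , vtx (σ d)) s j closed)

  Cover : List (V n) → Set
  Cover vs = Σ (List (List (V n))) λ Cs →
    All GoodCycle Cs × Unique (concat Cs) × Closed (concat Cs) × (∀ {v} → v ∈ vs → v ∈ concat Cs)

  -- Greedy: a vertex not yet covered contributes its orbit, cut at the least period so that no
  -- vertex repeats.
  cover : ∀ vs → Cover vs
  cover [] = [] , [] , [] , (λ _ ()) , λ ()
  cover (v ∷ vs) with cover vs
  ... | Cs , good , uniq , closed , covers with v ∈? concat Cs
  ...   | yes v∈ = Cs , good , uniq , closed , λ { (here refl) → v∈ ; (there p) → covers p }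
  ...   | no v∉ with period (v , true)
  ...     | N , pN with least (λ l → walk (suc l) (v , true) ≟ᴰ (v , true)) N pN
  ...       | j , pj , below =
    C ∷ Cs , orbit-good s j pj ∷ good , Unique.++⁺ (unique-orbit (suc j) s λ l l< → below l (s≤s⁻¹ l<)) uniq disjoint
    , closed′ , λ { (here refl) → here refl ; (there p) → ∈-++⁺ʳ C (covers p) }
    where
    s : Dart n
    s = v , true
    C : List (V n)
    C = map vtx (iterate σ s (suc j))
    -- From a common vertex, the walk back to `v` would stay in the closed set `concat Cs`, which
    -- does not contain `v`.
    disjoint : ∀ {x} → x ∈ C × x ∈ concat Cs → ⊥
    disjoint (x∈C , x∈Cs) with ∈-map⁻ vtx x∈C
    ... | d , d∈ , refl with ∈-iterate⁻ (suc j) s d∈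
    ...   | l , _ , refl = v∉ (subst (λ d → vtx d ∈ concat Cs) (walk-flip l s)
                              (Closed-walk closed l (flip (walk l s)) x∈Cs))
    closed′ : Closed (C ++ concat Cs)
    closed′ d d∈ with ∈-++⁻ C d∈
    ... | inj₁ p = ∈-++⁺ˡ (orbit-closed s j pj d p)
    ... | inj₂ p = ∈-++⁺ʳ C (closed d p)

  vertices : List (V n)
  vertices = map inj₁ (allFin n) ++ map inj₂ (allFin n)

  ∈-vertices : ∀ v → v ∈ vertices
  ∈-vertices (inj₁ i) = ∈-++⁺ˡ (∈-map⁺ inj₁ (∈-allFin i))
  ∈-vertices (inj₂ j) = ∈-++⁺ʳ (map inj₁ (allFin n)) (∈-map⁺ inj₂ (∈-allFin j))

  extract : Σ (List (List (V n))) λ Cs → IsPC2Factor c Cs × All (λ C → t ≤ length C) Cs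
  extract with cover vertices
  ... | Cs , good , uniq , _ , covers =
    Cs , ((All.map proj₁ good , uniq , λ v → covers (∈-vertices v)) , All.map (proj₁ ∘ proj₂) good)
    , All.map (proj₂ ∘ proj₂) good

theorem1p4 : (t n : ℕ) → 3 ≤ t → 1 ≤ n → (c : Coloring n) →
    (∀ (v : V n) → 2 * n + 3 * t ≤ 3 * colorDegree c v) →
    Σ (List (List (V n))) (λ H → IsPC2Factor c H × All (λ C → t ≤ length C) H)
-- Here `t = δ + 2`, and `h` is the integer part of `(t - 1) / 2`: cycles with more than `2 * h`
-- vertices then have at least `2 * h + 2 ≥ t`.
theorem1p4 t@(suc (suc δ)) n@(suc n′) 3≤t@(s≤s (s≤s 1≤δ)) _ c degree with parity (suc δ)
... | h , h-half = Extract.extract {t = t} {h = h} c 3≤t t≤ (proj₁ F) (proj₁ (proj₂ F)) (proj₂ (proj₂ F))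
  where
  open ≤-Reasoning
  -- The largest `k` with `3k + 3t ≤ n + 3`; `3t≤` shows that the subtraction is not truncated.
  k : ℕ
  k = (n + 3 ∸ 3 * t) / 3

  -- If D is the colour degree and m the multiplicity of `γ`, then `D + m ≤ n + 1` and
  -- `3D ≥ 2n + 3t`.
  thrice : ∀ z γ → 3 * count (λ j → col c z (opp z j) ≟ γ) + 3 * t ≤ n + 3
  thrice z γ = +-cancelˡ-≤ (2 * n) _ _ (begin
    2 * n + (3 * m + 3 * t)        ≡⟨ e₁ n m t ⟩
    2 * n + 3 * t + 3 * m          ≤⟨ +-monoˡ-≤ (3 * m) (degree z) ⟩
    3 * colorDegree c z + 3 * m    ≡⟨ *-distribˡ-+ 3 (colorDegree c z) m ⟨
    3 * (colorDegree c z + m)      ≤⟨ *-monoʳ-≤ 3 (multiplicity c z γ) ⟩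
    3 * (1 + n)                    ≡⟨ e₂ n ⟩
    2 * n + (n + 3)                ∎)
    where
    m : ℕ
    m = count (λ j → col c z (opp z j) ≟ γ)
    e₁ : ∀ n m t → 2 * n + (3 * m + 3 * t) ≡ 2 * n + 3 * t + 3 * m
    e₁ = solve-∀
    e₂ : ∀ n → 3 * (1 + n) ≡ 2 * n + (n + 3)
    e₂ = solve-∀

  bound : MultiplicityBound k c
  bound z γ = begin
    m                        ≡⟨ m*n/n≡m m 3 ⟨
    m * 3 / 3                ≤⟨ /-monoˡ-≤ 3 (m+n≤o⇒m≤o∸n (m * 3) (≤-trans (≤-reflexive (cong (_+ 3 * t) (*-comm m 3))) (thrice z γ))) ⟩
    k                        ∎
    where
    m : ℕ
    m = count (λ j → col c z (opp z j) ≟ γ)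

  -- The colour of an edge occurs at least once at its end.
  1≤k : 1 ≤ k
  1≤k = ≤-trans (≤-trans (≤-reflexive (sym (χ-yes (c Fin.zero Fin.zero ≟ c Fin.zero Fin.zero) refl))) (m≤m+n _ _))
    (bound (inj₁ Fin.zero) (c Fin.zero Fin.zero))

  3t≤ : 3 * t ≤ n + 3
  3t≤ = ≤-trans (m≤n+m (3 * t) _) (thrice (inj₁ Fin.zero) 0)

  k-size : k * 3 + 3 * t ≤ n + 3
  k-size = ≤-trans (+-monoˡ-≤ (3 * t) (m/n*n≤m (n + 3 ∸ 3 * t) 3)) (≤-reflexive (m∸n+n≡m 3t≤))

  ε≤ : 2 * h ≤ suc δ
  ε≤ = case h-half of λ where
    (inj₁ e) → ≤-reflexive (trans (*-comm 2 h) (sym e))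
    (inj₂ e) → ≤-trans (n≤1+n _) (≤-reflexive (trans (cong suc (*-comm 2 h)) (sym e)))

  t≤ : t ≤ suc h * 2
  t≤ = case h-half of λ where
    (inj₁ e) → ≤-trans (≤-reflexive (cong suc e)) (n≤1+n _)
    (inj₂ e) → ≤-reflexive (cong suc e)

  -- As `2h ≤ δ + 1 = t - 1`, the left side is at most `3k + 3(t - 1)`, which is at most `n` by
  -- `k-size`.
  n≥ : 2 * k + 2 * h + δ + (k + (1 + 2 * h)) ≤ n
  n≥ = +-cancelʳ-≤ 3 _ _ (begin
    2 * k + 2 * h + δ + (k + (1 + 2 * h)) + 3       ≡⟨ e₁ k (2 * h) δ ⟩
    k * 3 + (2 * h + 2 * h + δ + 4)                 ≤⟨ +-monoʳ-≤ (k * 3) (+-monoˡ-≤ 4 (+-monoˡ-≤ δ (+-mono-≤ ε≤ ε≤))) ⟩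
    k * 3 + (suc δ + suc δ + δ + 4)                 ≡⟨ e₂ k δ ⟩
    k * 3 + 3 * t                                   ≤⟨ k-size ⟩
    n + 3                                           ∎)
    where
    e₁ : ∀ k ε δ → 2 * k + ε + δ + (k + (1 + ε)) + 3 ≡ k * 3 + (ε + ε + δ + 4)
    e₁ = solve-∀
    e₂ : ∀ k δ → k * 3 + (suc δ + suc δ + δ + 4) ≡ k * 3 + 3 * (2 + δ)
    e₂ = solve-∀

  F : Factor h c
  F = factor-exists {h = h} c bound 1≤k 1≤δ ε≤ n≥
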